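{- For $n\ge3$ with $n\not\equiv2\pmod4$ and $k\ge3$, $$p_n(\Sigma^-_k)-p_n(\Sigma^-_{k-1})=C'(n,k)=L_k(n)-\sum_{i=2}^{k-1}\binom{n+k-i}{k-i}C'(n,i),$$ where $L_k(n)=\frac1n\sum_{d\mid n}\mu(d)k^{n/d}$ and $\mu$ is the Möbius function.
   Context: For $\sigma\in\{+,-\}^k$ ($k\ge2$), let $\mathcal W_k$ be the set of infinite words over $\{0,\dots,k-1\}$ with the linear order $\prec_\sigma$: for $s\neq t$, with $j$ the first index where $s_j\neq t_j$ and $c=|\{i<j:\sigma_{s_i}=-\}|$, $s\prec_\sigma t$ iff ($c$ even and $s_j<t_j$) or ($c$ odd and $s_j>t_j$). The signed shift $\Sigma_\sigma$ deletes the first letter of a word. Let $\mathcal W_{k,n}$ be the set of words $(s_1\dots s_n)^\infty$ with $s_1\dots s_n$ primitive (not a power of a shorter word). For $s\in\mathcal W_{k,n}$ let $\Pi_\sigma(s)\in\mathcal S_n$ be the permutation with $\Pi_\sigma(s)_i<\Pi_\sigma(s)_j$ iff $s_is_{i+1}\dots\prec_\sigma s_js_{j+1}\dots$. Let $\mathcal P_n(\Sigma_\sigma)=\{\Pi_\sigma(s):s\in\mathcal W_{k,n}\}$ and $p_n(\Sigma_\sigma)=|\mathcal P_n(\Sigma_\sigma)|/n$ (the number of classes of $\mathcal P_n(\Sigma_\sigma)$ under cyclic rotation). $\Sigma^-_k$ denotes the reverse $k$-shift $\Sigma_{ -^k}$ (all signs $-$). $C'(n,i)$ denotes the number of cyclic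 permutations ($n$-cycles) in $\mathcal S_n$ with exactly $i-1$ ascents, an ascent of $\tau$ being an $i\in[n-1]$ with $\tau_i<\tau_{i+1}$. -}

module Defs where

open import Data.Nat as ℕ using (ℕ; zero; suc; _+_; _*_; _∸_; _^_; _%_)
import Data.Nat.DivMod as ℕD
open import Data.Nat.Divisibility using (_∣?_)
open import Data.Nat.Primality using (prime?)
open import Data.Integer as ℤ using (ℤ; +_; -_)
open import Data.Integer.DivMod using (_/ℕ_)
open import Data.Fin as Fin using (Fin; toℕ)
open import Data.Fin.Properties using (all?; any?; _≟_)
open import Data.Vec as Vec using (Vec; []; _∷_; lookup; tabulate; toList)
open import Data.List as List using (List; []; _∷_; length; filter; concat; replicate; upTo; map)
open import Data.Bool.ListAction using (any)
open import Data.Nat.ListAction using (sum)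
open import Data.List.Relation.Unary.Unique.Propositional using (Unique)
open import Data.List.Relation.Unary.Unique.DecPropositional using (unique?)
open import Data.Product using (Σ; ∃; _×_; _,_)
open import Data.Sum using (_⊎_)
open import Data.Bool using (Bool; true; false; if_then_else_)
open import Function using (_∘_)
open import Function.Definitions using (Injective)
open import Relation.Nullary using (Dec; yes; no; ¬_; does)
open import Relation.Nullary.Decidable using (_×-dec_)
open import Relation.Binary.PropositionalEquality using (_≡_)
import Data.Nat.Properties as ℕP

data Sign : Set where
  plus minus : Sign

SignVec : ℕ → Set
SignVec k = Fin k → Sign

reverseSigns : (k : ℕ) → SignVec k
reverseSigns k _ = minus

Word : ℕ → Set
Word k = ℕ → Fin k

isMinus : Sign → Bool
isMinus plus  = false
isMinus minus = true

negCount : ∀ {k} → SignVec k → Word k → ℕ → ℕ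
negCount σ s zero    = 0
negCount σ s (suc j) = negCount σ s j + (if isMinus (σ (s j)) then 1 else 0)

_≺[_]_ : ∀ {k} → Word k → SignVec k → Word k → Set
s ≺[ σ ] t = ∃ λ j → (∀ i → i ℕ.< j → s i ≡ t i)
  × ((negCount σ s j % 2 ≡ 0 × s j Fin.< t j)
     ⊎ (negCount σ s j % 2 ≡ 1 × t j Fin.< s j))

shiftBy : ∀ {k} → ℕ → Word k → Word k
shiftBy i s m = s (i + m)

-- the first block s_1 … s_n (0-based here)
block : ∀ {k} (n : ℕ) → Word k → Vec (Fin k) n
block n s = tabulate (λ i → s (toℕ i))

Primitive : ∀ {A : Set} → List A → Set
Primitive {A} w = ∀ (u : List A) (r : ℕ) → concat (replicate r u) ≡ w → ¬ (length u ℕ.< length w)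

InW : ∀ {k} (n : ℕ) → Word k → Set
InW n s = (∀ m → s (n + m) ≡ s m) × Primitive (toList (block n s))

-- permutations of [n] in one-line notation (π_i = lookup π i, 0-based)
Perm : ℕ → Set
Perm n = Vec (Fin n) n

IsPerm : ∀ {n} → Perm n → Set
IsPerm π = Unique (toList π)

IsPattern : ∀ {k n} → SignVec k → Word k → Perm n → Set
IsPattern {n = n} σ s π =
  IsPerm π × (∀ (i j : Fin n) →
    (lookup π i Fin.< lookup π j → shiftBy (toℕ i) s ≺[ σ ] shiftBy (toℕ j) s)
    × (shiftBy (toℕ i) s ≺[ σ ] shiftBy (toℕ j) s → lookup π i Fin.< lookup π j))

InPatterns : ∀ {k} → SignVec k → (n : ℕ) → Perm n → Set
InPatterns {k} σ n π = ∃ λ (s : Word k) → InW n s × IsPattern σ s π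

HasCard : ∀ {A : Set} → (A → Set) → ℕ → Set
HasCard {A} P m = Σ (Fin m → A) λ f →
  Injective _≡_ _≡_ f × (∀ i → P (f i)) × (∀ a → P a → ∃ λ i → f i ≡ a)

quot : ℕ → ℕ → ℕ
quot a zero    = 0
quot a (suc m) = a ℕD./ suc m

allVecs : (k n : ℕ) → List (Vec (Fin k) n)
allVecs k zero    = [] ∷ []
allVecs k (suc n) = concat (map (λ a → map (a ∷_) (allVecs k n)) (List.allFin k))

iter : ∀ {n} → Perm n → ℕ → Fin n → Fin n
iter π zero    x = x
iter π (suc j) x = lookup π (iter π j x)

IsCycle : ∀ {n} → Perm n → Set
IsCycle {n} π = ∀ (x y : Fin n) → ∃ λ (j : Fin n) → iter π (toℕ j) x ≡ y

isCycle? : ∀ {n} (π : Perm n) → Dec (IsCycle π)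
isCycle? π = all? (λ x → all? (λ y → any? (λ j → iter π (toℕ j) x ≟ y)))

ascents : ∀ {n} → List (Fin n) → ℕ
ascents (a ∷ b ∷ rest) = (if does (toℕ a ℕ.<? toℕ b) then 1 else 0) + ascents (b ∷ rest)
ascents _ = 0

C′ : ℕ → ℕ → ℕ
C′ n i = length (filter
  (λ π → unique? _≟_ (toList π) ×-dec isCycle? π ×-dec (ascents (toList π) ℕ.≟ (i ∸ 1)))
  (allVecs n n))

hasSquareFactor : ℕ → Bool
hasSquareFactor d = any (λ p → does (suc (suc p) * suc (suc p) ∣? d)) (upTo d)

ω : ℕ → ℕ
ω d = length (filter (λ p → prime? p ×-dec (p ∣? d)) (upTo (suc d)))

μ : ℕ → ℤ
μ d = if hasSquareFactor d then + 0 else (- + 1) ℤ.^ ω d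

mobiusSum : ℕ → ℕ → ℤ
mobiusSum k n = List.foldr ℤ._+_ (+ 0)
  (map (λ d′ → if does (suc d′ ∣? n) then μ (suc d′) ℤ.* (+ (k ^ (n ℕD./ suc d′))) else + 0)
       (upTo n))

-- L_k(n) = (1/n) Σ_{d ∣ n} μ(d) k^{n/d}   (exact division; L_k(0) := 0)
L : ℕ → ℕ → ℤ
L k zero    = + 0
L k (suc m) = mobiusSum k (suc m) /ℕ suc m

correctionSum : ℕ → ℕ → ℤ
correctionSum n k = + sum (map (λ j → let i = j + 2 in ((n + k ∸ i) C (k ∸ i)) * C′ n i) (upTo (k ∸ 2)))
  where open import Data.Nat.Combinatorics using (_C_)

{-# OPTIONS --safe #-}
module Submission where

-- Let s be an n-periodic word whose n shifts are distinct, let π record their relative order and let τ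
-- be the n-cycle π_i ↦ π_{i+1}. Labelling π_i by the letter s_i gives a weakly increasing labelling f of
-- {0,…,n-1} with τ b < τ a whenever a < b carry equal labels, so f increases strictly at every ascent of
-- τ. Conversely a triple (τ, f, x) yields the word f(x) f(τ x) f(τ² x) …. If it had a period d < n, then
-- 2d would be a period too; even shifts preserve the order, so τ^{2d} x = x, whence n = 2d with d odd
-- (τ^d x = x if d is even), which n ≢ 2 (mod 4) excludes. Hence primitive words of length n over k letters
-- correspond to such triples, and patterns of the reverse k-shift to pairs (τ, x) with τ an n-cycle having
-- fewer than k ascents. A cycle with i - 1 ascents has C(n+k-i, k-i) labellings, and the primitive words
-- are counted by Möbius inversion over their least periods.

open import Defs
open import Data.Bool using (true; false; if_then_else_; T)
open import Data.Bool.Properties using (T-≡; ⇔→≡)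
open import Data.Empty using (⊥; ⊥-elim)
open import Data.Fin as Fin using (Fin; toℕ; zero; suc)
import Data.Fin.Properties as FinP
open import Data.Integer as ℤ using (ℤ; +_; -_; _-_)
import Data.Integer.Properties as ℤP
open import Data.List as List using (List; []; _∷_; _++_; length; concat; replicate; filter; foldr; upTo; map)
open import Data.List.Membership.Propositional using (_∈_; lose)
open import Data.List.Membership.Propositional.Properties using (∈-lookup; ∈-filter⁺; ∈-filter⁻; ∈-map⁺; ∈-map⁻; ∈-concat⁺′; ∈-allFin; ∈-upTo⁺; ∈-upTo⁻)
open import Data.List.Properties using (length-++; map-++; map-cong; map-applyUpTo; upTo-∷ʳ; filter-notAll; length-tabulate)
open import Data.List.Relation.Unary.All as All using (All; []; _∷_)
import Data.List.Relation.Unary.All.Properties as AllP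
open import Data.List.Relation.Unary.AllPairs as AllPairs using ([]; _∷_)
import Data.List.Relation.Unary.AllPairs.Properties as AllPairsP
open import Data.List.Relation.Unary.Any as Any using (here; there; index)
import Data.List.Relation.Unary.Any.Properties as AnyP
open import Data.List.Relation.Unary.Unique.DecPropositional using (unique?)
open import Data.List.Relation.Unary.Unique.Propositional using (Unique)
import Data.List.Relation.Unary.Unique.Propositional.Properties as UniqueP
open import Data.Nat as ℕ using (ℕ; zero; suc; _+_; _*_; _∸_; _≤_; _<_; z≤n; s≤s; NonZero; _%_; _/_)
open import Data.Nat.Combinatorics using (_C_; nCn≡1; nCk≡nC[n∸k]; nCk+nC[k+1]≡[n+1]C[k+1])
open import Data.Nat.Combinatorics.Specification using (k>n⇒nCk≡0)
open import Data.Nat.Coprimality using (Coprime; coprime-divisor)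
open import Data.Nat.Divisibility using (_∣_; _∣?_; divides; quotient; quotient≢0; quotient-∣; m∣n⇒n≡quotient*m; m%n≡0⇒n∣m; m/n∣m; m*n∣o⇒n∣o/m; m∣n/o⇒o*m∣n; ∣⇒≤; ∣-trans; ∣1⇒≡1; m∣m*n; ∣n⇒∣m*n; m*n∣⇒m∣; m*n∣⇒n∣; *-pres-∣; *-monoʳ-∣; *-monoˡ-∣; *-cancelˡ-∣; *-cancelʳ-∣)
open import Data.Nat.DivMod using (_mod_; m%n<n; m<n⇒m%n≡m; m≡m%n+[m/n]*n; [m+kn]%n≡m%n; [m+n]%n≡m%n; n%n≡0; m<n*o⇒m/o<n; m∣n⇒o%n%m≡o%m; m≥n⇒m/n>0; m*n/n≡m)
open import Data.Nat.ListAction using (sum)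
open import Data.Nat.ListAction.Properties using (sum-++)
open import Data.Nat.Primality using (Prime; prime?; euclidsLemma; prime⇒nonZero; prime⇒nonTrivial; prime⇒irreducible)
open import Data.Nat.Primality.Factorisation using (factorise; PrimeFactorisation)
import Data.Nat.Properties as ℕP
open import Data.Nat.Solver using (module +-*-Solver)
open import Data.Product using (∃; _×_; _,_; proj₁; proj₂)
open import Data.Sum as Sum using (_⊎_; inj₁; inj₂)
open import Data.Unit using (⊤; tt)
open import Data.Vec as Vec using (Vec; []; _∷_; lookup; toList; tabulate)
import Data.Vec.Properties as VecP
import Data.Vec.Relation.Unary.All.Properties as VAllP
open import Function using (_∘_; id)
open import Function.Bundles using (mk⇔; Equivalence)
open import Relation.Binary.Definitions using (tri<; tri≈; tri>)
open import Relation.Binary.PropositionalEquality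
open import Relation.Nullary using (Dec; yes; no; ¬_; contradiction; does)
open import Relation.Nullary.Decidable using (decidable-stable; ¬?; map′; dec-true; dec-false; _×-dec_)
open import Relation.Unary using (Decidable)
import Algebra.Properties.CommutativeSemigroup ℤP.+-commutativeSemigroup as ℤ+

open ≡-Reasoning

-- Both halves of the theorem come from sums over the same cycles. The factor n in the number of
-- pairs (τ, x) is the choice of x, which only rotates the pattern; so passing from k - 1 to k
-- letters adds C'(n,k) classes. Grouping the triples (τ, f, x) by the ascents of τ gives L_k(n) as
-- the sum over i ≤ k of C(n+k-i, k-i) C'(n,i). Its term i = k has coefficient 1 and its term i = 1
-- vanishes, so the recurrence is this identity solved for the last term.
--
-- The binomial has a direct explanation: subtracting from each label the number of ascents before
-- it leaves an arbitrary weakly increasing sequence of n letters out of k - i + 1.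
--
-- The obstacle is that two elements of the cycle might carry the same word: then no first
-- difference decides between them, and the word no longer determines τ. For n = 2 the decreasing
-- cycle with a constant labelling gives a constant word; the condition on n modulo 4 excludes this
-- behaviour.

private
  variable
    A B : Set
    k n : ℕ

-- Cardinalities

hasCard-≤ : {P : A → Set} {Q : B → Set} {a b : ℕ} (φ : A → B) →
  (∀ x → P x → Q (φ x)) → (∀ x y → P x → P y → φ x ≡ φ y → x ≡ y) →
  HasCard P a → HasCard Q b → a ≤ b
hasCard-≤ φ φ-Q φ-inj (f , f-inj , f-P , _) (g , _ , _ , g-sur) =
  FinP.injective⇒≤ {f = h} h-inj
  where
  h = λ i → proj₁ (g-sur (φ (f i)) (φ-Q _ (f-P i)))
  g∘h : ∀ i → g (h i) ≡ φ (f i)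
  g∘h i = proj₂ (g-sur (φ (f i)) (φ-Q _ (f-P i)))
  h-inj : ∀ {i j} → h i ≡ h j → i ≡ j
  h-inj {i} {j} eq = f-inj (φ-inj _ _ (f-P i) (f-P j)
    (trans (sym (g∘h i)) (trans (cong g eq) (g∘h j))))

hasCard-unique : {P : A → Set} {a b : ℕ} → HasCard P a → HasCard P b → a ≡ b
hasCard-unique ca cb = ℕP.≤-antisym
  (hasCard-≤ id (λ _ p → p) (λ _ _ _ _ e → e) ca cb)
  (hasCard-≤ id (λ _ p → p) (λ _ _ _ _ e → e) cb ca)

hasCard-image : {P : A → Set} {Q : B → Set} {m : ℕ} (φ : A → B) →
  (∀ x → P x → Q (φ x)) → (∀ x y → P x → P y → φ x ≡ φ y → x ≡ y) →
  (∀ y → Q y → ∃ λ x → P x × φ x ≡ y) → HasCard P m → HasCard Q m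
hasCard-image φ φ-Q φ-inj φ-sur (f , f-inj , f-P , f-sur) =
  φ ∘ f , (λ {i} {j} eq → f-inj (φ-inj _ _ (f-P i) (f-P j) eq)) , (λ i → φ-Q _ (f-P i)) , sur
  where
  sur : ∀ y → _ → ∃ λ i → φ (f i) ≡ y
  sur y q with φ-sur y q
  ... | x , px , φx≡y with f-sur x px
  ... | i , fi≡x = i , trans (cong φ fi≡x) φx≡y

hasCard-⇔ : {P Q : A → Set} {m : ℕ} → (∀ x → P x → Q x) → (∀ x → Q x → P x) →
  HasCard P m → HasCard Q m
hasCard-⇔ to from = hasCard-image id to (λ _ _ _ _ e → e) (λ y q → y , from y q , refl)

hasCard-∅ : {P : A → Set} → (∀ x → ¬ P x) → HasCard P 0
hasCard-∅ empty = (λ ()) , (λ {i} → λ _ → ⊥-elim (FinP.¬Fin0 i)) , (λ ()) , λ x p → ⊥-elim (empty x p)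

hasCard-⊎ : {P Q : A → Set} {a b : ℕ} → (∀ x → P x → Q x → ⊥) →
  HasCard P a → HasCard Q b → HasCard (λ x → P x ⊎ Q x) (a + b)
hasCard-⊎ {A = A} {P = P} {Q = Q} {a} {b} disjoint (f , f-inj , f-P , f-sur) (g , g-inj , g-Q , g-sur) =
  h ∘ Fin.splitAt a , h-inj , (λ i → h-PQ (Fin.splitAt a i)) , h-sur
  where
  h : Fin a ⊎ Fin b → A
  h = Sum.[ f , g ]′
  h-PQ : ∀ s → P (h s) ⊎ Q (h s)
  h-PQ (inj₁ i) = inj₁ (f-P i)
  h-PQ (inj₂ j) = inj₂ (g-Q j)
  h′-inj : ∀ s t → h s ≡ h t → s ≡ t
  h′-inj (inj₁ i) (inj₁ j) eq = cong inj₁ (f-inj eq)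
  h′-inj (inj₁ i) (inj₂ j) eq = ⊥-elim (disjoint _ (f-P i) (subst Q (sym eq) (g-Q j)))
  h′-inj (inj₂ i) (inj₁ j) eq = ⊥-elim (disjoint _ (f-P j) (subst Q eq (g-Q i)))
  h′-inj (inj₂ i) (inj₂ j) eq = cong inj₂ (g-inj eq)
  h-inj : ∀ {i j} → h (Fin.splitAt a i) ≡ h (Fin.splitAt a j) → i ≡ j
  h-inj {i} {j} eq = trans (sym (FinP.join-splitAt a b i))
    (trans (cong (Fin.join a b) (h′-inj (Fin.splitAt a i) (Fin.splitAt a j) eq)) (FinP.join-splitAt a b j))
  h-sur : ∀ x → P x ⊎ Q x → ∃ λ i → h (Fin.splitAt a i) ≡ x
  h-sur x (inj₁ p) with f-sur x p
  ... | i , eq = i Fin.↑ˡ b , trans (cong h (FinP.splitAt-↑ˡ a i b)) eq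
  h-sur x (inj₂ q) with g-sur x q
  ... | j , eq = a Fin.↑ʳ j , trans (cong h (FinP.splitAt-↑ʳ a b j)) eq

hasCard-Σ : {P : A → Set} {R : A → B → Set} {m c : ℕ} →
  HasCard P m → (∀ x → P x → HasCard (R x) c) →
  HasCard (λ xy → P (proj₁ xy) × R (proj₁ xy) (proj₂ xy)) (m * c)
hasCard-Σ {A = A} {B = B} {P = P} {R = R} {m} {c} (f , f-inj , f-P , f-sur) cardR =
  h ∘ Fin.remQuot c , h-inj , (λ i → let (q , r) = Fin.remQuot {m} c i in f-P q , proj₁ (proj₂ (proj₂ (cR q))) r) , h-sur
  where
  -- The enumeration of a fibre may depend on the evidence for `P`; always taking `f-P i` makes it
  -- depend on the index alone.
  cR : ∀ i → HasCard (R (f i)) c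
  cR i = cardR (f i) (f-P i)
  h : Fin m × Fin c → A × B
  h (i , j) = f i , proj₁ (cR i) j
  h′-inj : ∀ s t → h s ≡ h t → s ≡ t
  h′-inj (i , j) (i′ , j′) eq with f-inj (cong proj₁ eq)
  ... | refl = cong (i ,_) (proj₁ (proj₂ (cR i)) (cong proj₂ eq))
  h-inj : ∀ {i j} → h (Fin.remQuot c i) ≡ h (Fin.remQuot c j) → i ≡ j
  h-inj {i} {j} eq = trans (sym (FinP.combine-remQuot {m} c i))
    (trans (cong (λ (q , r) → Fin.combine q r) (h′-inj _ _ eq)) (FinP.combine-remQuot {m} c j))
  h-sur : ∀ xy → P (proj₁ xy) × R (proj₁ xy) (proj₂ xy) → ∃ λ i → h (Fin.remQuot c i) ≡ xy
  h-sur (x , y) (p , r) with f-sur x p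
  ... | i , refl with proj₂ (proj₂ (proj₂ (cR i))) y r
  ... | j , refl = Fin.combine i j , cong h (FinP.remQuot-combine i j)

sum-upTo-suc : ∀ (c : ℕ → ℕ) k → sum (map c (upTo (suc k))) ≡ sum (map c (upTo k)) + c k
sum-upTo-suc c k = begin
  sum (map c (upTo (suc k)))              ≡⟨ cong (sum ∘ map c) (upTo-∷ʳ k) ⟨
  sum (map c (upTo k List.++ k ∷ []))     ≡⟨ cong sum (map-++ c (upTo k) (k ∷ [])) ⟩
  sum (map c (upTo k) List.++ c k ∷ [])   ≡⟨ sum-++ (map c (upTo k)) (c k ∷ []) ⟩
  sum (map c (upTo k)) + (c k + 0)        ≡⟨ cong (_+_ (sum (map c (upTo k)))) (ℕP.+-identityʳ (c k)) ⟩
  sum (map c (upTo k)) + c k              ∎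

hasCard-⋃ : {R : ℕ → A → Set} {c : ℕ → ℕ} → (∀ {i j x} → R i x → R j x → i ≡ j) →
  (∀ i → HasCard (R i) (c i)) →
  ∀ k → HasCard (λ x → ∃ λ i → i < k × R i x) (sum (map c (upTo k)))
hasCard-⋃ disj cards zero = hasCard-∅ λ { _ (_ , () , _) }
hasCard-⋃ {A = A} {R = R} {c} disj cards (suc k) =
  subst (HasCard _) (sym (sum-upTo-suc c k))
    (hasCard-⇔ to from (hasCard-⊎ apart (hasCard-⋃ disj cards k) (cards k)))
  where
  apart : ∀ x → (∃ λ i → i < k × R i x) → R k x → ⊥
  apart x (i , i<k , r) r′ = ℕP.<-irrefl (disj r r′) i<k
  to : ∀ x → (∃ λ i → i < k × R i x) ⊎ R k x → ∃ λ i → i < suc k × R i x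
  to x (inj₁ (i , i<k , r)) = i , ℕP.m<n⇒m<1+n i<k , r
  to x (inj₂ r) = k , ℕP.≤-refl , r
  from : ∀ x → (∃ λ i → i < suc k × R i x) → (∃ λ i → i < k × R i x) ⊎ R k x
  from x (i , s≤s i≤k , r) with ℕP.m≤n⇒m<n∨m≡n i≤k
  ... | inj₁ i<k = inj₁ (i , i<k , r)
  ... | inj₂ refl = inj₂ r

lookup-unique-injective : {xs : List A} → Unique xs → ∀ i j → List.lookup xs i ≡ List.lookup xs j → i ≡ j
lookup-unique-injective (_ ∷ _) zero zero eq = refl
lookup-unique-injective {xs = x ∷ xs} (x∉ ∷ _) zero (suc j) eq = ⊥-elim (All.lookup x∉ (∈-lookup {xs = xs} j) eq)
lookup-unique-injective {xs = x ∷ xs} (x∉ ∷ _) (suc i) zero eq = ⊥-elim (All.lookup x∉ (∈-lookup {xs = xs} i) (sym eq))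
lookup-unique-injective (_ ∷ u) (suc i) (suc j) eq = cong suc (lookup-unique-injective u i j eq)

hasCard-list : {P : A → Set} {xs : List A} → Unique xs →
  (∀ {x} → x ∈ xs → P x) → (∀ {x} → P x → x ∈ xs) → HasCard P (length xs)
hasCard-list {xs = xs} unique sound complete =
  List.lookup xs , (λ {i} {j} → lookup-unique-injective unique i j) , (λ i → sound (∈-lookup {xs = xs} i)) ,
  λ x p → index (complete p) , sym (AnyP.lookup-index (complete p))

hasCard-filter : {P : A → Set} (P? : Decidable P) {xs : List A} → Unique xs → (∀ {x} → P x → x ∈ xs) →
  HasCard P (length (filter P? xs))
hasCard-filter P? {xs} unique complete = hasCard-list (UniqueP.filter⁺ P? unique)
  (λ x∈ → proj₂ (∈-filter⁻ P? {xs = xs} x∈)) (λ p → ∈-filter⁺ P? (complete p) p)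

hasCard-Fin : ∀ n → HasCard {A = Fin n} (λ _ → ⊤) n
hasCard-Fin n = id , id , _ , λ i _ → i , refl

∈-allVecs : ∀ {k n} (v : Vec (Fin k) n) → v ∈ allVecs k n
∈-allVecs [] = here refl
∈-allVecs {k} {suc n} (a ∷ v) =
  ∈-concat⁺′ (∈-map⁺ (a ∷_) (∈-allVecs v)) (∈-map⁺ (λ a → map (a ∷_) (allVecs k n)) (∈-allFin a))

allVecs-unique : ∀ k n → Unique (allVecs k n)
allVecs-unique k zero = [] ∷ []
allVecs-unique k (suc n) = UniqueP.concat⁺
  (AllP.map⁺ (All.universal (λ a → UniqueP.map⁺ VecP.∷-injectiveʳ (allVecs-unique k n)) (List.allFin k)))
  (AllPairsP.map⁺ (AllPairs.map disjoint (UniqueP.allFin⁺ k)))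
  where
  disjoint : ∀ {a b} → a ≢ b → ∀ {v} → ¬ (v ∈ map (a ∷_) (allVecs k n) × v ∈ map (b ∷_) (allVecs k n))
  disjoint a≢b (v∈a , v∈b) with ∈-map⁻ _ v∈a | ∈-map⁻ _ v∈b
  ... | _ , _ , refl | _ , _ , eq = a≢b (VecP.∷-injectiveˡ eq)

hasCard-Vec : ∀ k n → HasCard {A = Vec (Fin k) n} (λ _ → ⊤) (k ℕ.^ n)
hasCard-Vec k zero = (λ _ → []) , (λ { {zero} {zero} _ → refl }) , _ , λ { [] _ → zero , refl }
hasCard-Vec k (suc n) = hasCard-image (λ (a , v) → a ∷ v) _
  (λ { (a , v) (b , w) _ _ refl → refl }) (λ { (a ∷ v) _ → (a , v) , _ , refl })
  (hasCard-Σ (hasCard-Fin k) (λ _ _ → hasCard-Vec k n))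

-- Labellings compatible with a permutation

-- This compares two words of the reverse shift through their first letters `c`, `d` and the ranks
-- `x`, `y` of their tails: a shared first letter is negative and reverses the comparison of the
-- tails.
LexBefore : ∀ {n k} → Fin n → Fin k → Fin n → Fin k → Set
LexBefore x c y d = c Fin.< d ⊎ (c ≡ d × y Fin.< x)

Follows : ∀ {n k m} → Fin n → Fin k → Vec (Fin n) m → Vec (Fin k) m → Set
Follows x c []       []       = ⊤
Follows x c (y ∷ xs) (d ∷ cs) = LexBefore x c y d

-- Testing neighbours only allows the labellings to be counted by recursion on the length;
-- transitivity of `LexBefore` recovers all pairs.
Compatible : ∀ {n k m} → Vec (Fin n) m → Vec (Fin k) m → Set
Compatible []       []       = ⊤
Compatible (x ∷ xs) (c ∷ cs) = Follows x c xs cs × Compatible xs cs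

lexBefore-trans : ∀ {n k} {x y z : Fin n} {c d e : Fin k} →
  LexBefore x c y d → LexBefore y d z e → LexBefore x c z e
lexBefore-trans (inj₁ c<d)          (inj₁ d<e)          = inj₁ (ℕP.<-trans c<d d<e)
lexBefore-trans (inj₁ c<d)          (inj₂ (refl , _))   = inj₁ c<d
lexBefore-trans (inj₂ (refl , _))   (inj₁ d<e)          = inj₁ d<e
lexBefore-trans (inj₂ (refl , y<x)) (inj₂ (refl , z<y)) = inj₂ (refl , ℕP.<-trans z<y y<x)

follows-lookup : ∀ {n k m} (x : Fin n) (c : Fin k) (xs : Vec (Fin n) m) cs →
  Follows x c xs cs → Compatible xs cs → ∀ j → LexBefore x c (lookup xs j) (lookup cs j)
follows-lookup x c (y ∷ xs) (d ∷ cs) fol com zero = fol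
follows-lookup x c (y ∷ xs) (d ∷ cs) fol (fol′ , com) (suc j) =
  lexBefore-trans fol (follows-lookup y d xs cs fol′ com j)

compatible-lookup : ∀ {n k m} (xs : Vec (Fin n) m) (cs : Vec (Fin k) m) → Compatible xs cs →
  ∀ i j → i Fin.< j → LexBefore (lookup xs i) (lookup cs i) (lookup xs j) (lookup cs j)
compatible-lookup (x ∷ xs) (c ∷ cs) (fol , com) zero    (suc j) _         = follows-lookup x c xs cs fol com j
compatible-lookup (x ∷ xs) (c ∷ cs) (fol , com) (suc i) (suc j) (s≤s i<j) = compatible-lookup xs cs com i j i<j

lookup-compatible : ∀ {n k m} (xs : Vec (Fin n) m) (cs : Vec (Fin k) m) →
  (∀ i j → i Fin.< j → LexBefore (lookup xs i) (lookup cs i) (lookup xs j) (lookup cs j)) →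
  Compatible xs cs
lookup-compatible []           []           _   = tt
lookup-compatible (x ∷ [])     (c ∷ [])     _   = tt , tt
lookup-compatible (x ∷ y ∷ xs) (c ∷ d ∷ cs) lex =
  lex zero (suc zero) (s≤s z≤n) ,
  lookup-compatible (y ∷ xs) (d ∷ cs) (λ i j i<j → lex (suc i) (suc j) (s≤s i<j))

ascents-< : ∀ {n} {x y : Fin n} zs → x Fin.< y → ascents (x ∷ y ∷ zs) ≡ suc (ascents (y ∷ zs))
ascents-< {x = x} {y} zs x<y =
  cong (λ b → (if b then 1 else 0) + ascents (y ∷ zs)) (dec-true (toℕ x ℕ.<? toℕ y) x<y)

ascents-≮ : ∀ {n} {x y : Fin n} zs → ¬ (x Fin.< y) → ascents (x ∷ y ∷ zs) ≡ ascents (y ∷ zs)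
ascents-≮ {x = x} {y} zs x≮y =
  cong (λ b → (if b then 1 else 0) + ascents (y ∷ zs)) (dec-false (toℕ x ℕ.<? toℕ y) x≮y)

ascents-≤ : ∀ {n m} (x : Fin n) (xs : Vec (Fin n) m) → ascents (x ∷ toList xs) ≤ m
ascents-≤ x []       = z≤n
ascents-≤ x (y ∷ xs) with x FinP.<? y
... | yes x<y = ℕP.≤-trans (ℕP.≤-reflexive (ascents-< (toList xs) x<y)) (s≤s (ascents-≤ y xs))
... | no  x≮y = ℕP.≤-trans (ℕP.≤-reflexive (ascents-≮ (toList xs) x≮y)) (ℕP.m≤n⇒m≤1+n (ascents-≤ y xs))

-- Labels never decrease and rise by at least one at each ascent, so the last label, which is below
-- `k`, is at least the first plus the number of ascents.
compatible⇒ascents : ∀ {n k m} x (xs : Vec (Fin n) m) (c : Fin k) cs → Compatible (x ∷ xs) (c ∷ cs) →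
  ascents (x ∷ toList xs) + toℕ c < k
compatible⇒ascents x []       c []       _           = FinP.toℕ<n c
compatible⇒ascents x (y ∷ xs) c (d ∷ cs) (fol , com) with x FinP.<? y
... | yes x<y rewrite ascents-< (toList xs) x<y = ℕP.≤-<-trans
  (ℕP.≤-trans (ℕP.≤-reflexive (sym (ℕP.+-suc (ascents (y ∷ toList xs)) (toℕ c))))
    (ℕP.+-monoʳ-≤ (ascents (y ∷ toList xs)) (c<d fol)))
  (compatible⇒ascents y xs d cs com)
  where
  c<d : LexBefore x c y d → c Fin.< d
  c<d (inj₁ c<d)       = c<d
  c<d (inj₂ (_ , y<x)) = contradiction x<y (ℕP.<-asym y<x)
... | no  x≮y rewrite ascents-≮ (toList xs) x≮y = ℕP.≤-<-trans
  (ℕP.+-monoʳ-≤ (ascents (y ∷ toList xs)) (c≤d fol)) (compatible⇒ascents y xs d cs com)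
  where
  c≤d : LexBefore x c y d → c Fin.≤ d
  c≤d (inj₁ c<d)        = ℕP.<⇒≤ c<d
  c≤d (inj₂ (refl , _)) = ℕP.≤-refl

≮∧≢⇒> : ∀ {n} {x y : Fin n} → ¬ (x Fin.< y) → x ≢ y → y Fin.< x
≮∧≢⇒> x≮y x≢y = FinP.≤∧≢⇒< (ℕP.≮⇒≥ x≮y) (x≢y ∘ sym)

-- The witness is the least labelling starting at `l`: it rises by one at each ascent and is
-- constant elsewhere. Distinct entries make every other step a strict descent, as equal labels
-- require.
ascents⇒compatible : ∀ {n k m} x (xs : Vec (Fin n) m) → Unique (x ∷ toList xs) →
  ∀ l → ascents (x ∷ toList xs) + l < k →
  ∃ λ (c : Fin k) → ∃ λ cs → toℕ c ≡ l × Compatible (x ∷ xs) (c ∷ cs)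
ascents⇒compatible x [] _ l bound = Fin.fromℕ< bound , [] , FinP.toℕ-fromℕ< bound , tt , tt
ascents⇒compatible {k = k} x (y ∷ xs) ((x≢y ∷ _) ∷ unique) l bound with x FinP.<? y
... | yes x<y =
  let d , cs , d≡ , com = ascents⇒compatible y xs unique (suc l)
        (ℕP.≤-<-trans (ℕP.≤-reflexive (trans (ℕP.+-suc a l) (cong (_+ l) (sym (ascents-< (toList xs) x<y))))) bound)
  in c , d ∷ cs , c≡ , inj₁ (ℕP.≤-reflexive (trans (cong suc c≡) (sym d≡))) , com
  where
  a = ascents (y ∷ toList xs)
  l<k : l < k
  l<k = ℕP.≤-<-trans (ℕP.m≤n+m l (ascents (x ∷ y ∷ toList xs))) bound
  c = Fin.fromℕ< l<k
  c≡ = FinP.toℕ-fromℕ< l<k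
... | no x≮y =
  let d , cs , d≡ , com = ascents⇒compatible y xs unique l
        (subst (λ a → a + l < k) (ascents-≮ (toList xs) x≮y) bound)
  in d , d ∷ cs , d≡ , inj₂ (refl , ≮∧≢⇒> x≮y x≢y) , com

-- A bound on the first letter is enough, since compatible labels never decrease.
LettersFrom : ∀ {k m} → ℕ → Vec (Fin k) m → Set
LettersFrom l []      = ⊤
LettersFrom l (c ∷ _) = l ≤ toℕ c

-- Pascal's rule for a first step that is not an ascent: the tail keeps all `r` ascents and all
-- `suc q` letters. The bound on `r` prevents truncation in the subtraction.
count-step-≥ : ∀ m q r → r ≤ m →
  (suc m + q ∸ suc r) C suc m + (m + suc q ∸ suc r) C m ≡ (suc m + suc q ∸ suc r) C suc m
count-step-≥ m q r r≤m = begin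
  (m + q ∸ r) C suc m + (m + suc q ∸ suc r) C m ≡⟨ cong (λ a → (m + q ∸ r) C suc m + (a ∸ suc r) C m) (ℕP.+-suc m q) ⟩
  (m + q ∸ r) C suc m + (m + q ∸ r) C m         ≡⟨ ℕP.+-comm ((m + q ∸ r) C suc m) _ ⟩
  (m + q ∸ r) C m + (m + q ∸ r) C suc m         ≡⟨ nCk+nC[k+1]≡[n+1]C[k+1] (m + q ∸ r) m ⟩
  suc (m + q ∸ r) C suc m                       ≡⟨ cong (_C suc m) (ℕP.+-∸-assoc 1 (ℕP.≤-trans r≤m (ℕP.m≤m+n m q))) ⟨
  (suc (m + q) ∸ r) C suc m                     ≡⟨ cong (λ a → (a ∸ r) C suc m) (ℕP.+-suc m q) ⟨
  (m + suc q ∸ r) C suc m                       ∎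

-- Pascal's rule for a first step that is an ascent: the tail has one ascent fewer and one letter
-- fewer at its disposal.
count-step-< : ∀ m q r → suc r ≤ m →
  (suc m + q ∸ suc (suc r)) C suc m + (m + q ∸ suc r) C m ≡ (suc m + suc q ∸ suc (suc r)) C suc m
count-step-< m q r r<m = begin
  (m + q ∸ suc r) C suc m + (m + q ∸ suc r) C m ≡⟨ ℕP.+-comm ((m + q ∸ suc r) C suc m) _ ⟩
  (m + q ∸ suc r) C m + (m + q ∸ suc r) C suc m ≡⟨ nCk+nC[k+1]≡[n+1]C[k+1] (m + q ∸ suc r) m ⟩
  suc (m + q ∸ suc r) C suc m                   ≡⟨ cong (_C suc m) (ℕP.+-∸-assoc 1 (ℕP.≤-trans r<m (ℕP.m≤m+n m q))) ⟨
  (suc (m + q) ∸ suc r) C suc m                 ≡⟨ cong (λ a → (a ∸ suc r) C suc m) (ℕP.+-suc m q) ⟨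
  (m + suc q ∸ suc r) C suc m                   ∎

module _ {n k} (x : Fin n) (q : ℕ) (c₀ : Fin k) (c₀+q≡k : toℕ c₀ + suc q ≡ k) where

  private
    Total : ℕ → ℕ → ℕ → Set
    Total m b r = (suc (suc m) + q ∸ suc r) C suc (suc m) + b ≡ (suc (suc m) + suc q ∸ suc r) C suc (suc m)

  -- After the letter `c₀` the tail must start above `c₀` at an ascent, and at `c₀` or above
  -- otherwise. The count `b` differs in the two cases, so it is returned with the Pascal identity
  -- into which it fits; `card` is the induction hypothesis.
  follows-card : ∀ {m} (xs : Vec (Fin n) m) → Unique (x ∷ toList xs) →
    (∀ q l → l + q ≡ k → HasCard {A = Vec (Fin k) m} (λ cs → LettersFrom l cs × Compatible xs cs)
      ((m + q ∸ suc (ascents (toList xs))) C m)) →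
    ∃ λ b → HasCard (λ cs → Follows x c₀ xs cs × Compatible xs cs) b ×
      (suc m + q ∸ suc (ascents (x ∷ toList xs))) C suc m + b
        ≡ (suc m + suc q ∸ suc (ascents (x ∷ toList xs))) C suc m
  follows-card [] _ card = _ ,
    hasCard-⇔ (λ { [] _ → tt , tt }) (λ { [] _ → tt , tt }) (card (suc q) (toℕ c₀) c₀+q≡k) ,
    count-step-≥ 0 q 0 z≤n
  follows-card {suc m} (y ∷ ys) ((x≢y ∷ _) ∷ _) card with x FinP.<? y
  ... | yes x<y = _ ,
    hasCard-⇔ (λ { (d ∷ _) (c₀<d , com) → inj₁ c₀<d , com })
      (λ { (d ∷ _) (inj₁ c₀<d , com) → c₀<d , com
         ; (d ∷ _) (inj₂ (_ , y<x) , _) → contradiction x<y (ℕP.<-asym y<x) })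
      (card q (suc (toℕ c₀)) (trans (sym (ℕP.+-suc (toℕ c₀) q)) c₀+q≡k)) ,
    subst (Total m ((suc m + q ∸ suc (ascents (y ∷ toList ys))) C suc m))
      (sym (ascents-< (toList ys) x<y))
      (count-step-< (suc m) q (ascents (y ∷ toList ys)) (s≤s (ascents-≤ y ys)))
  ... | no x≮y = _ ,
    hasCard-⇔ lower upper (card (suc q) (toℕ c₀) c₀+q≡k) ,
    subst (Total m ((suc m + suc q ∸ suc (ascents (y ∷ toList ys))) C suc m))
      (sym (ascents-≮ (toList ys) x≮y))
      (count-step-≥ (suc m) q (ascents (y ∷ toList ys)) (ℕP.m≤n⇒m≤1+n (ascents-≤ y ys)))
    where
    lower : ∀ cs → LettersFrom (toℕ c₀) cs × Compatible (y ∷ ys) cs → Follows x c₀ (y ∷ ys) cs × Compatible (y ∷ ys) cs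
    lower (d ∷ _) (c₀≤d , com) with ℕP.m≤n⇒m<n∨m≡n c₀≤d
    ... | inj₁ c₀<d = inj₁ c₀<d , com
    ... | inj₂ c₀≡d = inj₂ (FinP.toℕ-injective c₀≡d , ≮∧≢⇒> x≮y x≢y) , com
    upper : ∀ cs → Follows x c₀ (y ∷ ys) cs × Compatible (y ∷ ys) cs → LettersFrom (toℕ c₀) cs × Compatible (y ∷ ys) cs
    upper (d ∷ _) (inj₁ c₀<d , com)       = ℕP.<⇒≤ c₀<d , com
    upper (d ∷ _) (inj₂ (refl , _) , com) = ℕP.≤-refl , com

-- Pascal's recursion: the first letter is either above the smallest admissible letter l or equal to it.
compatible-card-from : ∀ {n k m} (xs : Vec (Fin n) m) → Unique (toList xs) → ∀ q l → l + q ≡ k →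
  HasCard {A = Vec (Fin k) m} (λ cs → LettersFrom l cs × Compatible xs cs)
    ((m + q ∸ suc (ascents (toList xs))) C m)
compatible-card-from [] _ q l _ = (λ _ → []) , (λ { {zero} {zero} _ → refl }) , _ , λ { [] _ → zero , refl }
compatible-card-from {m = suc m} (x ∷ xs) _ zero l l+0≡k =
  -- No letter is left, and the binomial is zero because its upper index is at most `m`.
  subst (HasCard _) (sym (k>n⇒nCk≡0 (s≤s (ℕP.≤-trans
      (ℕP.m∸n≤m (m + 0) (ascents (x ∷ toList xs))) (ℕP.≤-reflexive (ℕP.+-identityʳ m))))))
    (hasCard-∅ λ { (c ∷ _) (l≤c , _) → ℕP.<-irrefl refl
      (ℕP.<-≤-trans (FinP.toℕ<n c) (ℕP.≤-trans (ℕP.≤-reflexive (trans (sym l+0≡k) (ℕP.+-identityʳ l))) l≤c)) })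
compatible-card-from {n} {k} {suc m} (x ∷ xs) unique (suc q) l l+q≡k =
  let b , card , total = first-card in subst (HasCard _) total
    (hasCard-⇔ to from (hasCard-⊎ apart (compatible-card-from (x ∷ xs) unique q (suc l) l+q≡k′)
      (hasCard-image {Q = First} (c₀ ∷_) (λ cs com → refl , com) (λ { _ _ _ _ refl → refl })
        (λ { (_ ∷ cs) (refl , com) → cs , com , refl }) card)))
  where
  l+q≡k′ = trans (sym (ℕP.+-suc l q)) l+q≡k
  l<k : l < k
  l<k = ℕP.≤-trans (s≤s (ℕP.m≤m+n l q)) (ℕP.≤-reflexive l+q≡k′)
  c₀ = Fin.fromℕ< l<k
  c₀≡l : toℕ c₀ ≡ l
  c₀≡l = FinP.toℕ-fromℕ< l<k
  First : Vec (Fin k) (suc m) → Set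
  First (c ∷ cs) = c ≡ c₀ × Compatible (x ∷ xs) (c ∷ cs)
  first-card = follows-card x q c₀ (trans (cong (_+ suc q) c₀≡l) l+q≡k) xs unique
    (compatible-card-from xs (AllPairs.tail unique))
  apart : ∀ cs → LettersFrom (suc l) cs × Compatible (x ∷ xs) cs → First cs → ⊥
  apart (c ∷ _) (l<c , _) (refl , _) = ℕP.<-irrefl (sym c₀≡l) l<c
  to : ∀ cs → (LettersFrom (suc l) cs × Compatible (x ∷ xs) cs) ⊎ First cs → LettersFrom l cs × Compatible (x ∷ xs) cs
  to (c ∷ cs) (inj₁ (l<c , com)) = ℕP.<⇒≤ l<c , com
  to (c ∷ cs) (inj₂ (refl , com)) = ℕP.≤-reflexive (sym c₀≡l) , com
  from : ∀ cs → LettersFrom l cs × Compatible (x ∷ xs) cs → (LettersFrom (suc l) cs × Compatible (x ∷ xs) cs) ⊎ First cs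
  from (c ∷ cs) (l≤c , com) with ℕP.m≤n⇒m<n∨m≡n l≤c
  ... | inj₁ l<c = inj₁ (l<c , com)
  ... | inj₂ l≡c = inj₂ (FinP.toℕ-injective (trans (sym l≡c) (sym c₀≡l)) , com)

compatible-card : ∀ {n k} (τ : Perm n) → IsPerm τ →
  HasCard {A = Vec (Fin k) n} (Compatible τ) ((n + k ∸ suc (ascents (toList τ))) C n)
compatible-card τ perm = hasCard-⇔ (λ _ → proj₂) (λ { [] com → tt , com ; (c ∷ cs) com → z≤n , com })
  (compatible-card-from τ perm _ 0 refl)

-- Bounded search and injective maps between finite sets

search : {P : ℕ → Set} → (∀ i → Dec (P i)) → ∀ N →
  (∀ i → i < N → ¬ P i) ⊎ (∃ λ i → i < N × P i × (∀ j → j < i → ¬ P j))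
search P? zero = inj₁ (λ _ ())
search {P} P? (suc N) with search P? N
... | inj₂ (i , i<N , p , least) = inj₂ (i , ℕP.m<n⇒m<1+n i<N , p , least)
... | inj₁ none with P? N
...   | yes p = inj₂ (N , ℕP.≤-refl , p , none)
...   | no ¬p = inj₁ none′
  where
  none′ : ∀ i → i < suc N → ¬ P i
  none′ i (s≤s i≤N) with ℕP.m≤n⇒m<n∨m≡n i≤N
  ... | inj₁ i<N  = none i i<N
  ... | inj₂ refl = ¬p

-- If `y` were missed, punching it out of the codomain would inject a finite set into a smaller one.
injective⇒surjective : (f : Fin n → Fin n) → (∀ {i j} → f i ≡ f j → i ≡ j) → ∀ y → ∃ λ x → f x ≡ y
injective⇒surjective {suc n} f inj y with FinP.any? (λ x → f x FinP.≟ y)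
... | yes found = found
... | no ¬found = contradiction
  (FinP.injective⇒≤ {f = λ x → Fin.punchOut {i = y} {j = f x} (λ eq → ¬found (x , sym eq))}
    (λ {i} {j} eq → inj (FinP.punchOut-injective {i = y} _ _ eq)))
  (ℕP.<⇒≱ (ℕP.n<1+n n))

unique⇒injective : (xs : Vec A n) → Unique (toList xs) → ∀ {i j} → lookup xs i ≡ lookup xs j → i ≡ j
unique⇒injective (x ∷ xs) _        {zero}  {zero}  _  = refl
unique⇒injective (x ∷ xs) (x∉ ∷ _) {zero}  {suc j} eq = contradiction eq (VAllP.lookup⁺ (VAllP.toList⁻ x∉) j)
unique⇒injective (x ∷ xs) (x∉ ∷ _) {suc i} {zero}  eq = contradiction (sym eq) (VAllP.lookup⁺ (VAllP.toList⁻ x∉) i)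
unique⇒injective (x ∷ xs) (_ ∷ u)  {suc i} {suc j} eq = cong suc (unique⇒injective xs u eq)

injective⇒unique : (xs : Vec A n) → (∀ {i j} → lookup xs i ≡ lookup xs j → i ≡ j) → Unique (toList xs)
injective⇒unique []       _   = []
injective⇒unique (x ∷ xs) inj =
  VAllP.toList⁺ (VAllP.lookup⁻ (λ i eq → contradiction (inj {zero} {suc i} eq) λ ()))
  ∷ injective⇒unique xs (λ eq → FinP.suc-injective (inj eq))

lookup-ext : {xs ys : Vec A n} → (∀ i → lookup xs i ≡ lookup ys i) → xs ≡ ys
lookup-ext {xs = xs} {ys} eq =
  trans (sym (VecP.tabulate∘lookup xs)) (trans (VecP.tabulate-cong eq) (VecP.tabulate∘lookup ys))

-- The alternating order

-- The order of letters after `j` reversals. Swapping the arguments at each level replaces the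
-- parity test by computation.
AltLess : ℕ → Fin n → Fin n → Set
AltLess zero    a b = a Fin.< b
AltLess (suc j) a b = AltLess j b a

altLess-irrefl : ∀ j {a : Fin n} → ¬ AltLess j a a
altLess-irrefl zero    = ℕP.<-irrefl refl
altLess-irrefl (suc j) = altLess-irrefl j

altLess-asym : ∀ j {a b : Fin n} → AltLess j a b → ¬ AltLess j b a
altLess-asym zero    = ℕP.<-asym
altLess-asym (suc j) = altLess-asym j

altLess-trans : ∀ j {a b c : Fin n} → AltLess j a b → AltLess j b c → AltLess j a c
altLess-trans zero    p q = ℕP.<-trans p q
altLess-trans (suc j) p q = altLess-trans j q p

altLess-tri : ∀ j {a b : Fin n} → a ≢ b → AltLess j a b ⊎ AltLess j b a
altLess-tri zero {a} {b} a≢b with FinP.<-cmp a b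
... | tri< a<b _ _ = inj₁ a<b
... | tri≈ _ a≡b _ = contradiction a≡b a≢b
... | tri> _ _ b<a = inj₂ b<a
altLess-tri (suc j) a≢b = altLess-tri j (a≢b ∘ sym)

altLess-even : ∀ h {p} {a b : Fin n} → AltLess ((h + h) + p) a b → AltLess p a b
altLess-even zero    lt = lt
altLess-even (suc h) lt rewrite ℕP.+-suc h h = altLess-even h lt

altLess⇒parity : ∀ j {a b : Fin n} → AltLess j a b → (j % 2 ≡ 0 × a Fin.< b) ⊎ (j % 2 ≡ 1 × b Fin.< a)
altLess⇒parity zero          lt = inj₁ (refl , lt)
altLess⇒parity (suc zero)    lt = inj₂ (refl , lt)
altLess⇒parity (suc (suc j)) lt = altLess⇒parity j lt

parity⇒altLess : ∀ j {a b : Fin n} → (j % 2 ≡ 0 × a Fin.< b) ⊎ (j % 2 ≡ 1 × b Fin.< a) → AltLess j a b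
parity⇒altLess zero          (inj₁ (_ , lt)) = lt
parity⇒altLess (suc zero)    (inj₂ (_ , lt)) = lt
parity⇒altLess (suc (suc j)) lt              = parity⇒altLess j lt

-- The order of the reverse shift: as every letter is negative, the number of negative letters
-- before position `j` is `j` itself.
_⊏_ : Word k → Word k → Set
s ⊏ t = ∃ λ j → (∀ i → i < j → s i ≡ t i) × AltLess j (s j) (t j)

negCount-reverse : (s : Word k) → ∀ j → negCount (reverseSigns k) s j ≡ j
negCount-reverse s zero    = refl
negCount-reverse s (suc j) = trans (ℕP.+-comm _ 1) (cong suc (negCount-reverse s j))

⊏⇒≺ : {s t : Word k} → s ⊏ t → s ≺[ reverseSigns k ] t
⊏⇒≺ {s = s} {t} (j , agree , lt) = j , agree ,
  subst (λ c → (c % 2 ≡ 0 × s j Fin.< t j) ⊎ (c % 2 ≡ 1 × t j Fin.< s j)) (sym (negCount-reverse s j)) (altLess⇒parity j lt)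

≺⇒⊏ : {s t : Word k} → s ≺[ reverseSigns k ] t → s ⊏ t
≺⇒⊏ {s = s} {t} (j , agree , lt) = j , agree , parity⇒altLess j
  (subst (λ c → (c % 2 ≡ 0 × s j Fin.< t j) ⊎ (c % 2 ≡ 1 × t j Fin.< s j)) (negCount-reverse s j) lt)

⊏-irrefl : {s t : Word k} → (∀ m → s m ≡ t m) → ¬ s ⊏ t
⊏-irrefl {s = s} eq (j , _ , lt) = altLess-irrefl j (subst (AltLess j (s j)) (sym (eq j)) lt)

⊏-resp : {s s′ t t′ : Word k} → (∀ m → s m ≡ s′ m) → (∀ m → t m ≡ t′ m) → s ⊏ t → s′ ⊏ t′
⊏-resp s≡ t≡ (j , agree , lt) =
  j , (λ i i<j → trans (sym (s≡ i)) (trans (agree i i<j) (t≡ i))) , subst₂ (AltLess j) (s≡ j) (t≡ j) lt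

⊏-trans : {s t u : Word k} → s ⊏ t → t ⊏ u → s ⊏ u
⊏-trans {s = s} {t} {u} (j , agree , lt) (j′ , agree′ , lt′) with ℕP.<-cmp j j′
... | tri< j<j′ _ _ = j , (λ i i<j → trans (agree i i<j) (agree′ i (ℕP.<-trans i<j j<j′))) ,
  subst (AltLess j (s j)) (agree′ j j<j′) lt
... | tri≈ _ refl _ = j , (λ i i<j → trans (agree i i<j) (agree′ i i<j)) , altLess-trans j lt lt′
... | tri> _ _ j′<j = j′ , (λ i i<j′ → trans (agree i (ℕP.<-trans i<j′ j′<j)) (agree′ i i<j′)) ,
  subst (λ c → AltLess j′ c (u j′)) (sym (agree j′ j′<j)) lt′

⊏-asym : {s t : Word k} → s ⊏ t → ¬ t ⊏ s
⊏-asym p q = ⊏-irrefl (λ _ → refl) (⊏-trans p q)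

-- Dropping a shared first letter removes one reversal and so exchanges the two sides; this is where
-- the shape of `LexBefore` comes from.
⊏-uncons : {s t : Word k} → s ⊏ t → s 0 Fin.< t 0 ⊎ (s 0 ≡ t 0 × (t ∘ suc) ⊏ (s ∘ suc))
⊏-uncons (zero  , agree , lt) = inj₁ lt
⊏-uncons (suc j , agree , lt) =
  inj₂ (agree 0 (s≤s z≤n) , j , (λ i i<j → sym (agree (suc i) (s≤s i<j))) , lt)

first-difference : (s t : Word k) → ∀ N → (∀ i → i < N → s i ≡ t i) ⊎
  (∃ λ j → (∀ i → i < j → s i ≡ t i) × s j ≢ t j)
first-difference s t N with search (λ i → ¬? (s i FinP.≟ t i)) N
... | inj₁ agree = inj₁ (λ i i<N → decidable-stable (s i FinP.≟ t i) (agree i i<N))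
... | inj₂ (j , _ , differ , agree) = inj₂ (j , (λ i i<j → decidable-stable (s i FinP.≟ t i) (agree i i<j)) , differ)

-- Periods of words

Period : ℕ → (ℕ → A) → Set
Period e s = ∀ m → s (e + m) ≡ s m

period-* : {s : ℕ → A} → ∀ e → Period e s → ∀ q → Period (q * e) s
period-* e per zero    m = refl
period-* {s = s} e per (suc q) m = trans (cong s (ℕP.+-assoc e (q * e) m)) (trans (per (q * e + m)) (period-* e per q m))

period-% : {s : ℕ → A} → ∀ e .{{_ : NonZero e}} → Period e s → ∀ m → s m ≡ s (m % e)
period-% {s = s} e per m = trans
  (cong s (trans (m≡m%n+[m/n]*n m e) (ℕP.+-comm (m % e) _)))
  (period-* e per (m / e) (m % e))

period-≗ : {s t : ℕ → A} → ∀ e .{{_ : NonZero e}} → Period e s → Period e t →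
  (∀ i → i < e → s i ≡ t i) → ∀ m → s m ≡ t m
period-≗ e per per′ agree m = trans (period-% e per m) (trans (agree (m % e) (m%n<n m e)) (sym (period-% e per′ m)))

period-shift : {s : ℕ → A} → ∀ e → Period e s → ∀ i → Period e (λ m → s (i + m))
period-shift {s = s} e per i m = trans
  (cong s (trans (sym (ℕP.+-assoc i e m)) (trans (cong (_+ m) (ℕP.+-comm i e)) (ℕP.+-assoc e i m))))
  (per (i + m))

-- The division step showing that the least positive period divides every period: a nonzero
-- remainder would be a smaller one.
period-remainder : {s : ℕ → A} → ∀ e p .{{_ : NonZero p}} → Period e s → Period p s → Period (e % p) s
period-remainder {s = s} e p perE perP m = begin
  s (e % p + m)                  ≡⟨ period-* p perP (e / p) (e % p + m) ⟨
  s (e / p * p + (e % p + m))    ≡⟨ cong s (ℕP.+-assoc (e / p * p) (e % p) m) ⟨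
  s (e / p * p + e % p + m)      ≡⟨ cong (λ z → s (z + m)) (trans (ℕP.+-comm _ (e % p)) (sym (m≡m%n+[m/n]*n e p))) ⟩
  s (e + m)                      ≡⟨ perE m ⟩
  s m                            ∎

-- The word and its shift by `e` both have period `n`, so comparing `n` positions decides their
-- equality.
period? : (s : Word k) → ∀ n .{{_ : NonZero n}} → Period n s → ∀ e → Dec (Period e s)
period? s n per e = map′
  (λ eq → period-≗ n (period-shift n per e) per
    (λ i i<n → subst (λ z → s (e + z) ≡ s z) (FinP.toℕ-fromℕ< i<n) (eq (Fin.fromℕ< i<n))))
  (λ perE i → perE (toℕ i))
  (FinP.all? (λ (i : Fin n) → s (e + toℕ i) FinP.≟ s (toℕ i)))

LeastPeriod : ℕ → (ℕ → A) → Set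
LeastPeriod p s = 0 < p × Period p s × (∀ e → Period e s → p ∣ e)

leastPeriod : (s : Word k) → ∀ n → 0 < n → Period n s → ∃ λ p → LeastPeriod p s
-- Searching over `suc i` leaves out 0, which is a period of every word.
leastPeriod s (suc n) _ per with search (λ i → period? s (suc n) per (suc i)) (suc n)
... | inj₁ none = contradiction per (none n ℕP.≤-refl)
... | inj₂ (i , _ , perI , least) = suc i , s≤s z≤n , perI , divides-all
  where
  divides-all : ∀ e → Period e s → suc i ∣ e
  divides-all e perE with e % suc i in eq | period-remainder e (suc i) perE perI | m%n<n e (suc i)
  ... | zero  | _    | _       = m%n≡0⇒n∣m e (suc i) eq
  ... | suc r | perR | s≤s r<i = contradiction perR (least r r<i)

-- The form in which primitivity is counted: it concerns periods of the infinite word and is decided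
-- by its least period.
Aperiodic : ℕ → (ℕ → A) → Set
Aperiodic n s = ∀ e → 0 < e → e < n → ¬ Period e s

nth : A → List A → ℕ → A
nth d []       _       = d
nth d (x ∷ xs) zero    = x
nth d (x ∷ xs) (suc i) = nth d xs i

nth-++ˡ : ∀ (d : A) xs ys i → i < length xs → nth d (xs ++ ys) i ≡ nth d xs i
nth-++ˡ d (x ∷ xs) ys zero    _         = refl
nth-++ˡ d (x ∷ xs) ys (suc i) (s≤s i<n) = nth-++ˡ d xs ys i i<n

nth-++ʳ : ∀ (d : A) xs ys i → nth d (xs ++ ys) (length xs + i) ≡ nth d ys i
nth-++ʳ d []       ys i = refl
nth-++ʳ d (x ∷ xs) ys i = nth-++ʳ d xs ys i

nth-power : ∀ (d : A) u r q i → i < length u → q < r →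
  nth d (concat (replicate r u)) (q * length u + i) ≡ nth d u i
nth-power d u (suc r) zero    i i<n _         = nth-++ˡ d u _ i i<n
nth-power d u (suc r) (suc q) i i<n (s≤s q<r) =
  trans (cong (nth d (u ++ concat (replicate r u))) (ℕP.+-assoc (length u) (q * length u) i))
    (trans (nth-++ʳ d u _ _) (nth-power d u r q i i<n q<r))

length-power : ∀ (u : List A) r → length (concat (replicate r u)) ≡ r * length u
length-power u zero    = refl
length-power u (suc r) = trans (length-++ u) (cong (_+_ (length u)) (length-power u r))

nth-block : ∀ d (s : Word k) n i → i < n → nth d (toList (block n s)) i ≡ s i
nth-block d s (suc n) zero    _         = refl
nth-block d s (suc n) (suc i) (s≤s i<n) = nth-block d (s ∘ suc) n i i<n

length-block : ∀ n (s : Word k) → length (toList (block n s)) ≡ n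
length-block n s = VecP.length-toList (block n s)

block-cong : ∀ n {s t : Word k} → (∀ m → s m ≡ t m) → block n s ≡ block n t
block-cong n eq = VecP.tabulate-cong (λ i → eq (toℕ i))

-- If the block is a power of `u`, every letter of the word is read from `u` at its index modulo the
-- length of `u`, which is thus a period. An empty `u` has only empty powers.
aperiodic⇒primitive : (s : Word k) → ∀ n → 0 < n → Period n s → Aperiodic n s → Primitive (toList (block n s))
aperiodic⇒primitive s n 0<n per aper []         r eq |u|<|w| =
  ℕP.<-irrefl (trans (sym (ℕP.*-zeroʳ r)) (trans (sym (length-power [] r)) (trans (cong length eq) (length-block n s)))) 0<n
aperiodic⇒primitive s n 0<n per aper u@(x ∷ xs) r eq |u|<|w| =
  aper e (s≤s z≤n) (subst (e <_) (length-block n s) |u|<|w|)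
    (λ m → trans (letter (e + m)) (trans
      (cong (nth x u) (trans (cong (_% e) (ℕP.+-comm e m)) ([m+n]%n≡m%n m e)))
      (sym (letter m))))
  where
  e = length u
  n≡re : n ≡ r * e
  n≡re = trans (sym (length-block n s)) (trans (cong length (sym eq)) (length-power u r))
  instance
    n≢0 : NonZero n
    n≢0 = ℕ.>-nonZero 0<n
  below : ∀ i → i < n → s i ≡ nth x u (i % e)
  below i i<n = begin
    s i                                               ≡⟨ nth-block x s n i i<n ⟨
    nth x (toList (block n s)) i                      ≡⟨ cong (λ w → nth x w i) eq ⟨
    nth x (concat (replicate r u)) i
      ≡⟨ cong (nth x (concat (replicate r u))) (trans (m≡m%n+[m/n]*n i e) (ℕP.+-comm (i % e) _)) ⟩
    nth x (concat (replicate r u)) (i / e * e + i % e)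
      ≡⟨ nth-power x u r (i / e) (i % e) (m%n<n i e) (m<n*o⇒m/o<n (subst (i <_) n≡re i<n)) ⟩
    nth x u (i % e)                                   ∎
  letter : ∀ m → s m ≡ nth x u (m % e)
  letter m = trans (period-% n per m) (trans (below (m % n) (m%n<n m n))
    (cong (nth x u) (m∣n⇒o%n%m≡o%m e n m (divides r n≡re))))

-- Coding cycles by words

iter-+ : (τ : Perm n) → ∀ i j x → iter τ (i + j) x ≡ iter τ i (iter τ j x)
iter-+ τ zero    j x = refl
iter-+ τ (suc i) j x = cong (lookup τ) (iter-+ τ i j x)

iter-swap : (τ : Perm n) → ∀ i j x → iter τ i (iter τ j x) ≡ iter τ j (iter τ i x)
iter-swap τ i j x = trans (sym (iter-+ τ i j x)) (trans (cong (λ z → iter τ z x) (ℕP.+-comm i j)) (iter-+ τ j i x))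

iter-*-fixed : (τ : Perm n) → ∀ e x → iter τ e x ≡ x → ∀ q → iter τ (q * e) x ≡ x
iter-*-fixed τ e x eq zero    = refl
iter-*-fixed τ e x eq (suc q) = trans (iter-+ τ e (q * e) x) (trans (cong (iter τ e) (iter-*-fixed τ e x eq q)) eq)

-- The one-line notation of the pattern is the cycle notation of `τ` written from `x`.
orbit : Perm n → Fin n → Perm n
orbit τ x = tabulate (λ i → iter τ (toℕ i) x)

module Cyclic {n : ℕ} .{{_ : NonZero n}} (τ : Perm n) (cyc : IsCycle τ) where

  -- Choosing for each `y` an exponent that leads from `x` to `y` is injective, hence onto by
  -- finiteness; so every exponent is the chosen one of the point it reaches.
  iter-exponent-injective : ∀ x {i j : Fin n} → iter τ (toℕ i) x ≡ iter τ (toℕ j) x → i ≡ j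
  iter-exponent-injective x {i} {j} eq with section-onto i | section-onto j
    where
    section : Fin n → Fin n
    section y = proj₁ (cyc x y)
    section-right : ∀ y → iter τ (toℕ (section y)) x ≡ y
    section-right y = proj₂ (cyc x y)
    section-onto : ∀ i → ∃ λ y → section y ≡ i × iter τ (toℕ i) x ≡ y
    section-onto i =
      let y , eq = injective⇒surjective section
            (λ {y} {z} eq → trans (sym (section-right y)) (trans (cong (λ j → iter τ (toℕ j) x) eq) (section-right z))) i
      in y , eq , trans (cong (λ j → iter τ (toℕ j) x) (sym eq)) (section-right y)
  ... | y , refl , ix≡y | z , refl , jx≡z = cong (λ w → proj₁ (cyc x w)) (trans (sym ix≡y) (trans eq jx≡z))

  iter-fixed-small : ∀ x e → e < n → iter τ e x ≡ x → e ≡ 0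
  iter-fixed-small x e e<n eq = trans (sym (FinP.toℕ-fromℕ< e<n)) (trans
    (cong toℕ (iter-exponent-injective x {Fin.fromℕ< e<n} {Fin.fromℕ< 0<n}
      (trans (cong (λ j → iter τ j x) (FinP.toℕ-fromℕ< e<n))
        (trans eq (sym (cong (λ j → iter τ j x) (FinP.toℕ-fromℕ< 0<n)))))))
    (FinP.toℕ-fromℕ< 0<n))
    where 0<n = ℕ.>-nonZero⁻¹ n

  -- Some `j` below `n` leads from the successor of `x` back to `x`; the return time `suc j` is
  -- positive, so it cannot be below `n` and equals `n`.
  iter-n : ∀ x → iter τ n x ≡ x
  iter-n x with cyc (lookup τ x) x
  ... | j , eq with ℕP.m≤n⇒m<n∨m≡n (FinP.toℕ<n j)
  ...   | inj₁ 1+j<n = contradiction (iter-fixed-small x (suc (toℕ j)) 1+j<n (trans (iter-swap τ 1 (toℕ j) x) eq)) λ ()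
  ...   | inj₂ 1+j≡n = trans (cong (λ z → iter τ z x) (sym 1+j≡n)) (trans (iter-swap τ 1 (toℕ j) x) eq)

  iter-% : ∀ x e → iter τ e x ≡ iter τ (e % n) x
  iter-% x e = begin
    iter τ e x                                    ≡⟨ cong (λ z → iter τ z x) (m≡m%n+[m/n]*n e n) ⟩
    iter τ (e % n + (e / n) * n) x                ≡⟨ iter-+ τ (e % n) _ x ⟩
    iter τ (e % n) (iter τ ((e / n) * n) x)       ≡⟨ cong (iter τ (e % n)) (iter-*-fixed τ n x (iter-n x) (e / n)) ⟩
    iter τ (e % n) x                              ∎

  iter-fixed⇒∣ : ∀ x e → iter τ e x ≡ x → n ∣ e
  iter-fixed⇒∣ x e eq = m%n≡0⇒n∣m e n (iter-fixed-small x (e % n) (m%n<n e n) (trans (sym (iter-% x e)) eq))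

  -- The iterate with exponent `n` - 1 is a left inverse of `τ`.
  cycle⇒perm : IsPerm τ
  cycle⇒perm = injective⇒unique τ λ {a} {b} eq → trans (sym (iter-n a)) (trans (unstep a)
    (trans (cong (iter τ (ℕ.pred n)) eq) (trans (sym (unstep b)) (iter-n b))))
    where
    unstep : ∀ a → iter τ n a ≡ iter τ (ℕ.pred n) (lookup τ a)
    unstep a = trans (cong (λ z → iter τ z a) (sym (ℕP.suc-pred n))) (iter-swap τ 1 (ℕ.pred n) a)

  orbit-perm : ∀ x → IsPerm (orbit τ x)
  orbit-perm x = injective⇒unique (orbit τ x) (λ {i} {j} eq → iter-exponent-injective x
    (trans (sym (VecP.lookup∘tabulate _ i)) (trans eq (VecP.lookup∘tabulate _ j))))

even-or-odd : ∀ d → (∃ λ h → d ≡ h + h) ⊎ (∃ λ h → d ≡ suc (h + h))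
even-or-odd zero = inj₁ (0 , refl)
even-or-odd (suc d) with even-or-odd d
... | inj₁ (h , refl) = inj₂ (h , refl)
... | inj₂ (h , refl) = inj₁ (suc h , cong suc (sym (ℕP.+-suc h h)))

odd+odd%4 : ∀ h → (suc (h + h) + suc (h + h)) % 4 ≡ 2
odd+odd%4 h = trans
  (cong (_% 4) (solve 1 (λ h → (con 1 :+ (h :+ h)) :+ (con 1 :+ (h :+ h)) := con 2 :+ h :* con 4) refl h))
  ([m+kn]%n≡m%n 2 h 4)
  where open +-*-Solver

module Coding {n k : ℕ} .{{_ : NonZero n}} (n%4≢2 : n % 4 ≢ 2) (τ : Perm n)
  (cyc : IsCycle τ) (f : Vec (Fin k) n) (com : Compatible τ f) where

  open Cyclic τ cyc

  -- The aim is that `letters` embeds the order of `Fin n` into that of words, so that `a` is the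
  -- rank of `letters a`.
  letters : Fin n → Word k
  letters a j = lookup f (iter τ j a)

  letters-iter : ∀ a d j → letters (iter τ d a) j ≡ letters a (d + j)
  letters-iter a d j = cong (lookup f) (trans (iter-swap τ j d a) (sym (iter-+ τ d j a)))

  letters-period : ∀ a → Period n (letters a)
  letters-period a j = trans (sym (letters-iter a n j)) (cong (λ z → letters z j) (iter-n a))

  -- Equal labels force `τ` to reverse the order, so a step through a shared letter raises the level
  -- by exactly one.
  altLess-step : ∀ p {a b} → AltLess p a b → lookup f a ≡ lookup f b → AltLess (suc p) (lookup τ a) (lookup τ b)
  altLess-step zero {a} {b} a<b eq with compatible-lookup τ f com a b a<b
  ... | inj₁ fa<fb       = contradiction fa<fb (ℕP.<-irrefl (cong toℕ eq))
  ... | inj₂ (_ , τb<τa) = τb<τa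
  altLess-step (suc p) lt eq = altLess-step p lt (sym eq)

  altLess-letter : ∀ p {a b} → AltLess p a b → lookup f a ≢ lookup f b → AltLess p (lookup f a) (lookup f b)
  altLess-letter zero {a} {b} a<b fa≢fb with compatible-lookup τ f com a b a<b
  ... | inj₁ fa<fb       = fa<fb
  ... | inj₂ (fa≡fb , _) = contradiction fa≡fb fa≢fb
  altLess-letter (suc p) lt fa≢fb = altLess-letter p lt (fa≢fb ∘ sym)

  -- Iterates `altLess-step` along shared letters. The starting level `p` covers both directions: 0
  -- for an increasing pair, 1 for a decreasing one.
  altLess-iter : ∀ j {p a b} → AltLess p a b → (∀ i → i < j → letters a i ≡ letters b i) →
    AltLess (j + p) (iter τ j a) (iter τ j b)
  altLess-iter zero    lt agree = lt
  altLess-iter (suc j) lt agree = altLess-step (j + _)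
    (altLess-iter j lt (λ i i<j → agree i (ℕP.m<n⇒m<1+n i<j))) (agree j ℕP.≤-refl)

  -- An even shift preserves the order, so iterating it gives a monotone chain, which returns to a after n steps.
  even-shift-increasing-impossible : ∀ h p a → Period (h + h) (letters a) → ¬ AltLess p a (iter τ (h + h) a)
  even-shift-increasing-impossible h p a per lt =
    altLess-irrefl p (subst (AltLess p a)
      (trans (cong (λ z → iter τ z a) n*e) (iter-*-fixed τ n a (iter-n a) e)) (climb (ℕ.pred n)))
    where
    e = h + h
    n*e : suc (ℕ.pred n) * e ≡ e * n
    n*e = trans (cong (_* e) (ℕP.suc-pred n)) (ℕP.*-comm n e)
    step : ∀ q → AltLess p (iter τ (q * e) a) (iter τ (suc q * e) a)
    step zero    = subst (AltLess p a) (cong (λ z → iter τ z a) (sym (ℕP.+-identityʳ e))) lt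
    step (suc q) = subst₂ (AltLess p) (sym (iter-+ τ e (q * e) a)) (sym (iter-+ τ e (suc q * e) a))
      -- Both points lie a multiple of the period `e` further along, so their words agree; the
      -- `h + h` reversals cancel.
      (altLess-even h {p} (altLess-iter e {p} (step q) λ i _ →
        trans (letters-iter a (q * e) i) (trans (period-* e per q i)
          (sym (trans (letters-iter a (suc q * e) i) (period-* e per (suc q) i))))))
    climb : ∀ q → AltLess p a (iter τ (suc q * e) a)
    climb zero    = step zero
    climb (suc q) = altLess-trans p (climb q) (step (suc q))

  even-period-fixed : ∀ h a → Period (h + h) (letters a) → iter τ (h + h) a ≡ a
  even-period-fixed h a per with iter τ (h + h) a FinP.≟ a
  ... | yes eq = eq
  ... | no neq with altLess-tri 0 neq
  -- Level 1 is the reversed order, so here the excluded chain descends from `a`.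
  ...   | inj₁ lt = contradiction lt (even-shift-increasing-impossible h 1 a per)
  ...   | inj₂ lt = contradiction lt (even-shift-increasing-impossible h 0 a per)

  -- A period d gives the even period 2d, so n divides 2d; if d is odd then n = 2d is 2 modulo 4.
  period-fixed : ∀ d a → d < n → Period d (letters a) → iter τ d a ≡ a
  period-fixed d a d<n per with even-or-odd d
  ... | inj₁ (h , refl) = even-period-fixed h a per
  ... | inj₂ (h , refl)
    with iter-fixed⇒∣ a (d + d) (even-period-fixed d a
           (λ m → trans (cong (letters a) (ℕP.+-assoc d d m)) (trans (per (d + m)) (per m))))
  -- Since 0 < 2d < 2n, only the quotient 1 could occur.
  ...   | divides zero          ()
  ...   | divides (suc zero)    eq = contradiction
          (trans (cong (_% 4) (sym (trans eq (ℕP.+-identityʳ n)))) (odd+odd%4 h)) n%4≢2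
  ...   | divides (suc (suc q)) eq = contradiction eq (ℕP.<⇒≢
          (ℕP.<-≤-trans (ℕP.+-mono-< d<n d<n) (ℕP.+-monoʳ-≤ n (ℕP.m≤m+n n (q * n)))))

  -- As `b` is reached from `a` after some `d` below `n` steps, equal words make `d` a period, and
  -- `period-fixed` returns `a`.
  letters-injective : ∀ {a b} → (∀ m → letters a m ≡ letters b m) → a ≡ b
  letters-injective {a} {b} eq with cyc a b
  ... | d , refl = sym (period-fixed (toℕ d) a (FinP.toℕ<n d)
    (λ m → trans (sym (letters-iter a (toℕ d) m)) (sym (eq m))))

  -- A first difference exists by `letters-injective`. Up to it, each step reverses the order of the
  -- points just as each negative letter reverses `⊏`.
  letters-mono : ∀ {a b} → a Fin.< b → letters a ⊏ letters b
  letters-mono {a} {b} a<b with first-difference (letters a) (letters b) n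
  ... | inj₁ agree = contradiction a<b (ℕP.<-irrefl (cong toℕ
          (letters-injective (period-≗ n (letters-period a) (letters-period b) agree))))
  ... | inj₂ (j , agree , differ) = j , agree ,
          altLess-letter j (subst (λ p → AltLess p (iter τ j a) (iter τ j b)) (ℕP.+-identityʳ j)
            (altLess-iter j {0} a<b agree)) differ

  letters-cancel : ∀ {a b} → letters a ⊏ letters b → a Fin.< b
  letters-cancel {a} {b} lt with FinP.<-cmp a b
  ... | tri< a<b _ _  = a<b
  ... | tri≈ _ refl _ = contradiction lt (⊏-irrefl (λ _ → refl))
  ... | tri> _ _ b<a  = contradiction lt (⊏-asym (letters-mono b<a))

  letters-aperiodic : ∀ a → Aperiodic n (letters a)
  letters-aperiodic a e 0<e e<n per =
    ℕP.<-irrefl (sym (iter-fixed-small a e e<n (period-fixed e a e<n per))) 0<e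

  letters-InW : ∀ a → InW n (letters a)
  letters-InW a = letters-period a ,
    aperiodic⇒primitive (letters a) n (ℕ.>-nonZero⁻¹ n) (letters-period a) (letters-aperiodic a)

  letters-pattern : ∀ a → IsPattern (reverseSigns k) (letters a) (orbit τ a)
  letters-pattern a = orbit-perm a , λ i j → to i j , from i j
    where
    shift : ∀ (i : Fin n) m → letters (lookup (orbit τ a) i) m ≡ shiftBy (toℕ i) (letters a) m
    shift i m = trans (cong (λ z → letters z m) (VecP.lookup∘tabulate _ i)) (letters-iter a (toℕ i) m)
    to : ∀ i j → lookup (orbit τ a) i Fin.< lookup (orbit τ a) j →
      shiftBy (toℕ i) (letters a) ≺[ reverseSigns k ] shiftBy (toℕ j) (letters a)
    to i j lt = ⊏⇒≺ (⊏-resp (shift i) (shift j) (letters-mono lt))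
    from : ∀ i j → shiftBy (toℕ i) (letters a) ≺[ reverseSigns k ] shiftBy (toℕ j) (letters a) →
      lookup (orbit τ a) i Fin.< lookup (orbit τ a) j
    from i j lt = letters-cancel (⊏-resp (λ m → sym (shift i m)) (λ m → sym (shift j m)) (≺⇒⊏ lt))

-- Decoding a periodic word with a given pattern

toℕ-mod : ∀ i n .{{_ : NonZero n}} → toℕ (i mod n) ≡ i % n
toℕ-mod i n = FinP.toℕ-fromℕ< (m%n<n i n)

mod-cong : ∀ {i j} n .{{_ : NonZero n}} → i % n ≡ j % n → i mod n ≡ j mod n
mod-cong {i} {j} n eq = FinP.toℕ-injective (trans (toℕ-mod i n) (trans eq (sym (toℕ-mod j n))))

toℕ-mod-inverse : ∀ {n} .{{_ : NonZero n}} (i : Fin n) → toℕ i mod n ≡ i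
toℕ-mod-inverse {n} i = FinP.toℕ-injective (trans (toℕ-mod (toℕ i) n) (m<n⇒m%n≡m (FinP.toℕ<n i)))

%-+ : ∀ j i n .{{_ : NonZero n}} → (j + i % n) % n ≡ (j + i) % n
%-+ j i n = trans (sym ([m+kn]%n≡m%n (j + i % n) (i / n) n))
  (cong (_% n) (trans (ℕP.+-assoc j (i % n) _) (cong (_+_ j) (sym (m≡m%n+[m/n]*n i n)))))

module Decoding {n k : ℕ} .{{_ : NonZero n}} (s : Word k) (per : Period n s)
  (π : Perm n) (pat : IsPattern (reverseSigns k) s π) where

  -- Reducing indices modulo `n` spares a separate case for the successor at the end of the period.
  at : ℕ → Fin n
  at i = lookup π (i mod n)

  private
    π-injective : ∀ {i j} → lookup π i ≡ lookup π j → i ≡ j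
    π-injective = unique⇒injective π (proj₁ pat)

    π-surjective : ∀ x → ∃ λ i → lookup π i ≡ x
    π-surjective = injective⇒surjective (lookup π) π-injective

  position : Fin n → Fin n
  position x = proj₁ (π-surjective x)

  at-position : ∀ x → at (toℕ (position x)) ≡ x
  at-position x = trans (cong (lookup π) (toℕ-mod-inverse (position x))) (proj₂ (π-surjective x))

  position-at : ∀ i → position (at i) ≡ i mod n
  position-at i = π-injective (proj₂ (π-surjective (at i)))

  successor : Perm n
  successor = tabulate (λ x → at (suc (toℕ (position x))))

  labels : Vec (Fin k) n
  labels = tabulate (λ x → s (toℕ (position x)))

  successor-at : ∀ i → lookup successor (at i) ≡ at (suc i)
  successor-at i = trans (VecP.lookup∘tabulate _ (at i)) (cong (lookup π) (mod-cong n
    (trans (cong (λ z → suc z % n) (trans (cong toℕ (position-at i)) (toℕ-mod i n))) (%-+ 1 i n))))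

  labels-at : ∀ i → lookup labels (at i) ≡ s i
  labels-at i = trans (VecP.lookup∘tabulate _ (at i))
    (trans (cong s (trans (cong toℕ (position-at i)) (toℕ-mod i n))) (sym (period-% n per i)))

  iter-successor : ∀ j i → iter successor j (at i) ≡ at (j + i)
  iter-successor zero    i = refl
  iter-successor (suc j) i = trans (cong (lookup successor) (iter-successor j i)) (successor-at (j + i))

  successor-cycle : IsCycle successor
  -- The exponent is the difference of the positions modulo `n`; adding `n` first keeps the
  -- subtraction from truncating.
  successor-cycle x y = (b + (n ∸ a)) mod n , (begin
    iter successor (toℕ ((b + (n ∸ a)) mod n)) x        ≡⟨ cong₂ (iter successor) (toℕ-mod _ n) (sym (at-position x)) ⟩
    iter successor ((b + (n ∸ a)) % n) (at a)           ≡⟨ iter-successor _ a ⟩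
    at ((b + (n ∸ a)) % n + a)                          ≡⟨ cong (lookup π) (mod-cong n residue) ⟩
    at b                                                ≡⟨ at-position y ⟩
    y                                                   ∎)
    where
    a = toℕ (position x)
    b = toℕ (position y)
    residue : ((b + (n ∸ a)) % n + a) % n ≡ b % n
    residue = begin
      ((b + (n ∸ a)) % n + a) % n  ≡⟨ cong (_% n) (ℕP.+-comm _ a) ⟩
      (a + (b + (n ∸ a)) % n) % n  ≡⟨ %-+ a (b + (n ∸ a)) n ⟩
      (a + (b + (n ∸ a))) % n      ≡⟨ cong (_% n) (trans (ℕP.+-comm a _) (ℕP.+-assoc b (n ∸ a) a)) ⟩
      (b + (n ∸ a + a)) % n        ≡⟨ cong (λ z → (b + z) % n) (ℕP.m∸n+n≡m (ℕP.<⇒≤ (FinP.toℕ<n (position x)))) ⟩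
      (b + n) % n                  ≡⟨ [m+n]%n≡m%n b n ⟩
      b % n                        ∎

  shift-mod : ∀ i m → shiftBy (toℕ (i mod n)) s m ≡ shiftBy i s m
  shift-mod i m = begin
    s (toℕ (i mod n) + m)       ≡⟨ cong (λ z → s (z + m)) (toℕ-mod i n) ⟩
    s (i % n + m)               ≡⟨ period-% n per _ ⟩
    s ((i % n + m) % n)
      ≡⟨ cong s (trans (cong (_% n) (ℕP.+-comm _ m)) (trans (%-+ m i n) (cong (_% n) (ℕP.+-comm m i)))) ⟩
    s ((i + m) % n)             ≡⟨ period-% n per _ ⟨
    s (i + m)                   ∎

  at-mono : ∀ i j → shiftBy i s ⊏ shiftBy j s → at i Fin.< at j
  at-mono i j lt = proj₂ (proj₂ pat (i mod n) (j mod n))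
    (⊏⇒≺ (⊏-resp (λ m → sym (shift-mod i m)) (λ m → sym (shift-mod j m)) lt))

  at-cancel : ∀ i j → at i Fin.< at j → shiftBy i s ⊏ shiftBy j s
  at-cancel i j lt = ⊏-resp (shift-mod i) (shift-mod j) (≺⇒⊏ (proj₁ (proj₂ pat (i mod n) (j mod n)) lt))

  -- As `at i` is the rank of the shift by `i`, this is `⊏-uncons` for two shifts, with the tails
  -- replaced by their ranks.
  at-compatible : ∀ i j → at i Fin.< at j →
    LexBefore (lookup successor (at i)) (lookup labels (at i)) (lookup successor (at j)) (lookup labels (at j))
  at-compatible i j lt rewrite labels-at i | labels-at j | successor-at i | successor-at j
    with ⊏-uncons (at-cancel i j lt)
  ... | inj₁ si<sj = inj₁ (subst₂ Fin._<_ (cong s (ℕP.+-identityʳ i)) (cong s (ℕP.+-identityʳ j)) si<sj)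
  ... | inj₂ (si≡sj , tails) = inj₂
    (subst₂ _≡_ (cong s (ℕP.+-identityʳ i)) (cong s (ℕP.+-identityʳ j)) si≡sj ,
     at-mono (suc j) (suc i) (⊏-resp (λ m → cong s (ℕP.+-suc j m)) (λ m → cong s (ℕP.+-suc i m)) tails))

  successor-compatible : Compatible successor labels
  successor-compatible = lookup-compatible successor labels λ x y x<y →
    subst₂ (λ x y → LexBefore (lookup successor x) (lookup labels x) (lookup successor y) (lookup labels y))
      (at-position x) (at-position y)
      (at-compatible _ _ (subst₂ Fin._<_ (sym (at-position x)) (sym (at-position y)) x<y))

  orbit-successor : orbit successor (at 0) ≡ π
  orbit-successor = lookup-ext λ i → trans (VecP.lookup∘tabulate _ i) (trans (iter-successor (toℕ i) 0)
    (cong (lookup π) (trans (cong (_mod n) (ℕP.+-identityʳ (toℕ i))) (toℕ-mod-inverse i))))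

  labels-orbit : ∀ j → lookup labels (iter successor j (at 0)) ≡ s j
  labels-orbit j = trans (cong (lookup labels) (iter-successor j 0)) (trans (labels-at (j + 0)) (cong s (ℕP.+-identityʳ j)))

-- Reduction of exponents modulo `n` extends the agreement to all iterates. Every point is an
-- iterate of `x`, so its successor is the next one; the exponent `n % n` gives the starting point.
orbit-injective : .{{_ : NonZero n}} (τ τ′ : Perm n) → IsCycle τ → IsCycle τ′ → ∀ x x′ →
  orbit τ x ≡ orbit τ′ x′ → τ ≡ τ′ × x ≡ x′
orbit-injective {n} τ τ′ cyc cyc′ x x′ eq =
  lookup-ext successors , subst (λ i → iter τ i x ≡ iter τ′ i x′) (n%n≡0 n) (iters n)
  where
  iters% : ∀ (i : Fin n) → iter τ (toℕ i) x ≡ iter τ′ (toℕ i) x′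
  iters% i = trans (sym (VecP.lookup∘tabulate _ i)) (trans (cong (λ π → lookup π i) eq) (VecP.lookup∘tabulate _ i))
  iters : ∀ i → iter τ (i % n) x ≡ iter τ′ (i % n) x′
  iters i = subst (λ j → iter τ j x ≡ iter τ′ j x′) (toℕ-mod i n) (iters% (i mod n))
  iters′ : ∀ i → iter τ i x ≡ iter τ′ i x′
  iters′ i = trans (Cyclic.iter-% τ cyc x i) (trans (iters i) (sym (Cyclic.iter-% τ′ cyc′ x′ i)))
  successors : ∀ a → lookup τ a ≡ lookup τ′ a
  successors a with cyc x a
  ... | j , refl = trans (iters′ (suc (toℕ j))) (cong (lookup τ′) (sym (iters′ (toℕ j))))

-- Induction on the value of `π` at `i`: the value just below is taken at some `j`, and `π′ i`
-- strictly exceeds `π′ j`.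
order-preserving-≤ : (π π′ : Perm n) → IsPerm π →
  (∀ i j → lookup π i Fin.< lookup π j → lookup π′ i Fin.< lookup π′ j) →
  ∀ i → lookup π i Fin.≤ lookup π′ i
order-preserving-≤ {n} π π′ perm mono i = bound (toℕ (lookup π i)) i refl
  where
  bound : ∀ m i → toℕ (lookup π i) ≡ m → m ≤ toℕ (lookup π′ i)
  bound zero    i _  = z≤n
  bound (suc m) i eq =
    let m<n = ℕP.<-trans (ℕP.≤-reflexive (sym eq)) (FinP.toℕ<n (lookup π i))
        j , πj≡m = injective⇒surjective (lookup π) (unique⇒injective π perm) (Fin.fromℕ< m<n)
        πj≡m′ = trans (cong toℕ πj≡m) (FinP.toℕ-fromℕ< m<n)
    in ℕP.≤-<-trans (bound m j πj≡m′) (mono j i (ℕP.≤-reflexive (trans (cong suc πj≡m′) (sym eq))))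

pattern-unique : (σ : SignVec k) (s : Word k) (π π′ : Perm n) → IsPattern σ s π → IsPattern σ s π′ → π ≡ π′
pattern-unique σ s π π′ (perm , pat) (perm′ , pat′) = lookup-ext λ i → FinP.≤-antisym
  (order-preserving-≤ π π′ perm (λ i j lt → proj₂ (pat′ i j) (proj₁ (pat i j) lt)) i)
  (order-preserving-≤ π′ π perm′ (λ i j lt → proj₂ (pat i j) (proj₁ (pat′ i j) lt)) i)

-- The pattern of an aperiodic word, by ranking its shifts

length-filter-≤ : {P Q : A → Set} (P? : Decidable P) (Q? : Decidable Q) → (∀ x → P x → Q x) →
  ∀ xs → length (List.filter P? xs) ≤ length (List.filter Q? xs)
length-filter-≤ P? Q? P⇒Q [] = z≤n
length-filter-≤ P? Q? P⇒Q (x ∷ xs) with P? x | Q? x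
... | yes p | yes q = s≤s (length-filter-≤ P? Q? P⇒Q xs)
... | yes p | no ¬q = contradiction (P⇒Q x p) ¬q
... | no ¬p | yes q = ℕP.m≤n⇒m≤1+n (length-filter-≤ P? Q? P⇒Q xs)
... | no ¬p | no ¬q = length-filter-≤ P? Q? P⇒Q xs

length-filter-< : {P Q : A → Set} (P? : Decidable P) (Q? : Decidable Q) → (∀ x → P x → Q x) →
  ∀ {x xs} → x ∈ xs → ¬ P x → Q x → length (List.filter P? xs) < length (List.filter Q? xs)
length-filter-< P? Q? P⇒Q {x} {.x ∷ xs} (here refl) ¬px qx with P? x | Q? x
... | yes p | _     = contradiction p ¬px
... | no _  | yes _ = s≤s (length-filter-≤ P? Q? P⇒Q xs)
... | no _  | no ¬q = contradiction qx ¬q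
length-filter-< P? Q? P⇒Q {x} {y ∷ xs} (there x∈) ¬px qx with P? y | Q? y
... | yes p | yes q = s≤s (length-filter-< P? Q? P⇒Q x∈ ¬px qx)
... | yes p | no ¬q = contradiction (P⇒Q y p) ¬q
... | no ¬p | yes q = ℕP.m≤n⇒m≤1+n (length-filter-< P? Q? P⇒Q x∈ ¬px qx)
... | no ¬p | no ¬q = length-filter-< P? Q? P⇒Q x∈ ¬px qx

module Ranking {n k : ℕ} .{{_ : NonZero n}} (s : Word k) (per : Period n s) (aper : Aperiodic n s) where

  private
    _◁_ : Fin n → Fin n → Set
    i ◁ j = shiftBy (toℕ i) s ⊏ shiftBy (toℕ j) s

  -- Equal shifts by `a` and `b` would make `b ∸ a` a period: moving a further `n ∸ a` letters turns
  -- the shift by `a` into a full period.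
  shifts-differ : ∀ (i j : Fin n) → i Fin.< j → ¬ (∀ m → shiftBy (toℕ i) s m ≡ shiftBy (toℕ j) s m)
  shifts-differ i j i<j eq = aper (b ∸ a) (ℕP.m<n⇒0<n∸m i<j) (ℕP.≤-<-trans (ℕP.m∸n≤m b a) (FinP.toℕ<n j)) λ m → begin
    s (b ∸ a + m)                  ≡⟨ per _ ⟨
    s (n + (b ∸ a + m))            ≡⟨ cong (λ z → s (z + (b ∸ a + m))) (ℕP.m+[n∸m]≡n (ℕP.<⇒≤ (FinP.toℕ<n i))) ⟨
    s (a + (n ∸ a) + (b ∸ a + m))
      ≡⟨ cong s (solve 4 (λ a c d m → a :+ c :+ (d :+ m) := (a :+ d) :+ (c :+ m)) refl a (n ∸ a) (b ∸ a) m) ⟩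
    s (a + (b ∸ a) + (n ∸ a + m))  ≡⟨ cong (λ z → s (z + (n ∸ a + m))) (ℕP.m+[n∸m]≡n (ℕP.<⇒≤ i<j)) ⟩
    s (b + (n ∸ a + m))            ≡⟨ eq _ ⟨
    s (a + (n ∸ a + m))            ≡⟨ cong s (ℕP.+-assoc a (n ∸ a) m) ⟨
    s (a + (n ∸ a) + m)            ≡⟨ cong (λ z → s (z + m)) (ℕP.m+[n∸m]≡n (ℕP.<⇒≤ (FinP.toℕ<n i))) ⟩
    s (n + m)                      ≡⟨ per m ⟩
    s m                            ∎
    where
    open +-*-Solver
    a = toℕ i
    b = toℕ j

  ◁-tri : ∀ {i j} → i ≢ j → i ◁ j ⊎ j ◁ i
  ◁-tri {i} {j} i≢j with first-difference (shiftBy (toℕ i) s) (shiftBy (toℕ j) s) n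
  ... | inj₂ (m , agree , differ) =
    Sum.map (λ lt → m , agree , lt) (λ lt → m , (λ l l<m → sym (agree l l<m)) , lt) (altLess-tri m differ)
  ... | inj₁ agree with period-≗ n (period-shift n per (toℕ i)) (period-shift n per (toℕ j)) agree | altLess-tri 0 i≢j
  ...   | eq | inj₁ i<j = contradiction eq (shifts-differ i j i<j)
  ...   | eq | inj₂ j<i = contradiction (λ m → sym (eq m)) (shifts-differ j i j<i)

  _◁?_ : ∀ i j → Dec (i ◁ j)
  i ◁? j with i FinP.≟ j
  ... | yes refl = no (⊏-irrefl (λ _ → refl))
  ... | no i≢j with ◁-tri i≢j
  ...   | inj₁ i◁j = yes i◁j
  ...   | inj₂ j◁i = no (⊏-asym j◁i)

  rank : Fin n → ℕ
  rank i = length (List.filter (_◁? i) (List.allFin n))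

  rank<n : ∀ i → rank i < n
  rank<n i = subst (rank i <_) (length-tabulate id)
    (filter-notAll (_◁? i) (List.allFin n) (lose (∈-allFin i) (⊏-irrefl (λ _ → refl))))

  rank-mono : ∀ {i j} → i ◁ j → rank i < rank j
  rank-mono {i} {j} i◁j = length-filter-< (_◁? i) (_◁? j)
    (λ l l◁i → ⊏-trans l◁i i◁j) (∈-allFin i) (⊏-irrefl (λ _ → refl)) i◁j

  ranking : Perm n
  ranking = tabulate (λ i → Fin.fromℕ< (rank<n i))

  toℕ-ranking : ∀ i → toℕ (lookup ranking i) ≡ rank i
  toℕ-ranking i = trans (cong toℕ (VecP.lookup∘tabulate _ i)) (FinP.toℕ-fromℕ< (rank<n i))

  ranking-mono : ∀ {i j} → i ◁ j → lookup ranking i Fin.< lookup ranking j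
  ranking-mono {i} {j} i◁j = subst₂ _<_ (sym (toℕ-ranking i)) (sym (toℕ-ranking j)) (rank-mono i◁j)

  ranking-cancel : ∀ {i j} → lookup ranking i Fin.< lookup ranking j → i ◁ j
  ranking-cancel {i} {j} lt with i FinP.≟ j
  ... | yes refl = contradiction lt (ℕP.<-irrefl refl)
  ... | no i≢j with ◁-tri i≢j
  ...   | inj₁ i◁j = i◁j
  ...   | inj₂ j◁i = contradiction lt (ℕP.<-asym (ranking-mono j◁i))

  ranking-perm : IsPerm ranking
  ranking-perm = injective⇒unique ranking λ {i} {j} eq → decidable-stable (i FinP.≟ j) λ i≢j →
    Sum.[ (λ i◁j → ℕP.<-irrefl (cong toℕ eq) (ranking-mono i◁j))
        , (λ j◁i → ℕP.<-irrefl (cong toℕ (sym eq)) (ranking-mono j◁i)) ]′ (◁-tri i≢j)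

  ranking-pattern : IsPattern (reverseSigns k) s ranking
  ranking-pattern = ranking-perm , λ i j → (λ lt → ⊏⇒≺ (ranking-cancel lt)) , (λ lt → ranking-mono (≺⇒⊏ lt))

-- Sums over lists and ranges

if-yes : {P : Set} (P? : Dec P) {x y : A} → P → (if does P? then x else y) ≡ x
if-yes P? {x} {y} p = cong (λ b → if b then x else y) (dec-true P? p)

if-no : {P : Set} (P? : Dec P) {x y : A} → ¬ P → (if does P? then x else y) ≡ y
if-no P? {x} {y} ¬p = cong (λ b → if b then x else y) (dec-false P? ¬p)

T-does : {P : Set} (P? : Dec P) → T (does P?) → P
T-does (yes p) _ = p

sumℤ : (A → ℤ) → List A → ℤ
sumℤ f xs = foldr ℤ._+_ (+ 0) (map f xs)

sumℤ-cong : {f g : A → ℤ} → (∀ x → f x ≡ g x) → ∀ xs → sumℤ f xs ≡ sumℤ g xs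
sumℤ-cong eq []       = refl
sumℤ-cong eq (x ∷ xs) = cong₂ ℤ._+_ (eq x) (sumℤ-cong eq xs)

sumℤ-zero : ∀ (xs : List A) → sumℤ (λ _ → + 0) xs ≡ + 0
sumℤ-zero []       = refl
sumℤ-zero (x ∷ xs) = trans (ℤP.+-identityˡ _) (sumℤ-zero xs)

+-interchange : ∀ a b c d → (a ℤ.+ b) ℤ.+ (c ℤ.+ d) ≡ (a ℤ.+ c) ℤ.+ (b ℤ.+ d)
+-interchange = ℤ+.interchange

sumℤ-+ : (f g : A → ℤ) → ∀ xs → sumℤ (λ x → f x ℤ.+ g x) xs ≡ sumℤ f xs ℤ.+ sumℤ g xs
sumℤ-+ f g []       = refl
sumℤ-+ f g (x ∷ xs) = trans (cong (ℤ._+_ (f x ℤ.+ g x)) (sumℤ-+ f g xs)) (+-interchange (f x) (g x) _ _)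

sumℤ-swap : (f : A → B → ℤ) → ∀ xs ys →
  sumℤ (λ x → sumℤ (f x) ys) xs ≡ sumℤ (λ y → sumℤ (λ x → f x y) xs) ys
sumℤ-swap f []       ys = sym (sumℤ-zero ys)
sumℤ-swap f (x ∷ xs) ys = trans (cong (ℤ._+_ (sumℤ (f x) ys)) (sumℤ-swap f xs ys)) (sym (sumℤ-+ (f x) _ ys))

sumℤ-*ˡ : ∀ c (f : A → ℤ) xs → c ℤ.* sumℤ f xs ≡ sumℤ (λ x → c ℤ.* f x) xs
sumℤ-*ˡ c f []       = ℤP.*-zeroʳ c
sumℤ-*ˡ c f (x ∷ xs) = trans (ℤP.*-distribˡ-+ c (f x) _) (cong (ℤ._+_ (c ℤ.* f x)) (sumℤ-*ˡ c f xs))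

sumℤ-indicator : {P : A → Set} (P? : Decidable P) → ∀ xs →
  sumℤ (λ x → if does (P? x) then + 1 else + 0) xs ≡ + length (filter P? xs)
sumℤ-indicator P? [] = refl
sumℤ-indicator P? (x ∷ xs) with does (P? x)
... | true  = cong (ℤ._+_ (+ 1)) (sumℤ-indicator P? xs)
... | false = trans (ℤP.+-identityˡ _) (sumℤ-indicator P? xs)

-- Summation over 1, ..., N, indexed as in `mobiusSum`.
Σ₁ : ℕ → (ℕ → ℤ) → ℤ
Σ₁ N f = sumℤ (λ d → f (suc d)) (upTo N)

Σ₁-suc : ∀ f N → Σ₁ (suc N) f ≡ Σ₁ N f ℤ.+ f (suc N)
Σ₁-suc f N = trans (cong (sumℤ (f ∘ suc)) (sym (upTo-∷ʳ N))) (snoc (upTo N))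
  where
  snoc : ∀ xs → sumℤ (f ∘ suc) (xs ++ N ∷ []) ≡ sumℤ (f ∘ suc) xs ℤ.+ f (suc N)
  snoc []       = ℤP.+-comm (f (suc N)) (+ 0)
  snoc (x ∷ xs) = trans (cong (ℤ._+_ (f (suc x))) (snoc xs)) (sym (ℤP.+-assoc (f (suc x)) _ _))

Σ₁-cong : ∀ {f g} N → (∀ d → 0 < d → d ≤ N → f d ≡ g d) → Σ₁ N f ≡ Σ₁ N g
Σ₁-cong zero eq = refl
Σ₁-cong {f} {g} (suc N) eq = trans (Σ₁-suc f N) (trans
  (cong₂ ℤ._+_ (Σ₁-cong N (λ d 0<d d≤N → eq d 0<d (ℕP.m≤n⇒m≤1+n d≤N))) (eq (suc N) (s≤s z≤n) ℕP.≤-refl))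
  (sym (Σ₁-suc g N)))

Σ₁-zero : ∀ {f} N → (∀ d → 0 < d → d ≤ N → f d ≡ + 0) → Σ₁ N f ≡ + 0
Σ₁-zero N eq = trans (Σ₁-cong N eq) (sumℤ-zero (upTo N))

Σ₁-single : ∀ {f} N c → 0 < c → c ≤ N → (∀ d → d ≢ c → f d ≡ + 0) → Σ₁ N f ≡ f c
Σ₁-single zero    (suc c) _ () _
Σ₁-single {f} (suc N) c 0<c c≤1+N vanish with ℕP.m≤n⇒m<n∨m≡n c≤1+N
... | inj₁ (s≤s c≤N) = trans (Σ₁-suc f N) (trans
        (cong₂ ℤ._+_ (Σ₁-single N c 0<c c≤N vanish) (vanish (suc N) (λ eq → ℕP.<-irrefl (sym eq) (s≤s c≤N))))
        (ℤP.+-identityʳ (f c)))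
... | inj₂ refl = trans (Σ₁-suc f N) (trans
        (cong (ℤ._+ f c) (Σ₁-zero N (λ d _ d≤N → vanish d (λ eq → ℕP.<-irrefl eq (s≤s d≤N)))))
        (ℤP.+-identityˡ (f c)))

-- The Möbius function

-- The defining search stops below `d`; that is far enough, because a square dividing a positive `d`
-- has its root at most `d`.
hasSquareFactor⁺ : ∀ {d q} → 0 < d → 2 ≤ q → q * q ∣ d → T (hasSquareFactor d)
hasSquareFactor⁺ {d} {suc (suc p)} 0<d (s≤s (s≤s _)) q²∣d = AnyP.any⁺ _ (lose (∈-upTo⁺ p<d)
  (Equivalence.from T-≡ (dec-true (suc (suc p) * suc (suc p) ∣? d) q²∣d)))
  where
  p<d : p < d
  p<d = ℕP.≤-trans (ℕP.≤-trans (ℕP.n≤1+n (suc p)) (ℕP.m≤m*n (suc (suc p)) (suc (suc p)))) (∣⇒≤ {{ℕ.>-nonZero 0<d}} q²∣d)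

hasSquareFactor⁻ : ∀ {d} → T (hasSquareFactor d) → ∃ λ q → 2 ≤ q × q * q ∣ d
hasSquareFactor⁻ {d} sq with Any.satisfied (AnyP.any⁻ _ (upTo d) sq)
... | p , q²∣d = suc (suc p) , s≤s (s≤s z≤n) , T-does (suc (suc p) * suc (suc p) ∣? d) q²∣d

ω-card : ∀ {d} → 0 < d → HasCard (λ p → Prime p × p ∣ d) (ω d)
ω-card {d} 0<d = hasCard-filter (λ p → prime? p ×-dec (p ∣? d)) (UniqueP.upTo⁺ (suc d))
  (λ (_ , p∣d) → ∈-upTo⁺ (s≤s (∣⇒≤ {{ℕ.>-nonZero 0<d}} p∣d)))

prime∤⇒coprime : ∀ {p m} → Prime p → ¬ p ∣ m → Coprime m p
prime∤⇒coprime p-prime p∤m {d} (d∣m , d∣p) with prime⇒irreducible p-prime d∣p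
... | inj₁ d≡1  = d≡1
... | inj₂ refl = contradiction d∣m p∤m

module _ {p e : ℕ} (p-prime : Prime p) (0<e : 0 < e) where

  private
    0<p : 0 < p
    0<p = ℕ.>-nonZero⁻¹ p {{prime⇒nonZero p-prime}}
    0<pe : 0 < p * e
    0<pe = ℕP.*-mono-≤ 0<p 0<e
    2≤p : 2 ≤ p
    2≤p = ℕ.nonTrivial⇒n>1 p {{prime⇒nonTrivial p-prime}}

  μ-∣ : p ∣ e → μ (p * e) ≡ + 0
  μ-∣ p∣e = cong (λ b → if b then + 0 else (- + 1) ℤ.^ ω (p * e))
    (Equivalence.to T-≡ (hasSquareFactor⁺ 0<pe 2≤p (*-monoʳ-∣ p p∣e)))

  -- Let q² divide p·e. If p divides q, then p² divides p·e and p divides e; otherwise q² is coprime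
  -- to p and divides e.
  hasSquareFactor-∤ : ¬ p ∣ e → hasSquareFactor (p * e) ≡ hasSquareFactor e
  hasSquareFactor-∤ p∤e = ⇔→≡ (mk⇔ (λ eq → Equivalence.to T-≡ (to (Equivalence.from T-≡ eq)))
                                    (λ eq → Equivalence.to T-≡ (from (Equivalence.from T-≡ eq))))
    where
    to : T (hasSquareFactor (p * e)) → T (hasSquareFactor e)
    to sq with hasSquareFactor⁻ sq
    ... | q , 2≤q , q²∣pe with p ∣? q
    ...   | yes p∣q = contradiction (*-cancelˡ-∣ p {{prime⇒nonZero p-prime}} (∣-trans (*-pres-∣ p∣q p∣q) q²∣pe)) p∤e
    ...   | no p∤q  = hasSquareFactor⁺ 0<e 2≤q (coprime-divisor (prime∤⇒coprime p-prime p∤q²) q²∣pe)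
      where
      p∤q² : ¬ p ∣ q * q
      p∤q² p∣q² = Sum.[ p∤q , p∤q ]′ (euclidsLemma q q p-prime p∣q²)
    from : T (hasSquareFactor e) → T (hasSquareFactor (p * e))
    from sq with hasSquareFactor⁻ sq
    ... | q , 2≤q , q²∣e = hasSquareFactor⁺ 0<pe 2≤q (∣n⇒∣m*n p q²∣e)

  ω-∤ : ¬ p ∣ e → ω (p * e) ≡ suc (ω e)
  ω-∤ p∤e = trans (hasCard-unique (ω-card 0<pe) (hasCard-⇔ to from
      (hasCard-⊎ apart (ω-card 0<e) singleton))) (ℕP.+-comm (ω e) 1)
    where
    singleton : HasCard (_≡ p) 1
    singleton = (λ _ → p) , (λ { {zero} {zero} _ → refl }) , (λ _ → refl) , λ { _ refl → zero , refl }
    apart : ∀ q → Prime q × q ∣ e → q ≡ p → ⊥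
    apart q (_ , q∣e) refl = p∤e q∣e
    to : ∀ q → (Prime q × q ∣ e) ⊎ q ≡ p → Prime q × q ∣ p * e
    to q (inj₁ (q-prime , q∣e)) = q-prime , ∣n⇒∣m*n p q∣e
    to q (inj₂ refl)            = p-prime , m∣m*n e
    from : ∀ q → Prime q × q ∣ p * e → (Prime q × q ∣ e) ⊎ q ≡ p
    from q (q-prime , q∣pe) with euclidsLemma p e q-prime q∣pe
    ... | inj₂ q∣e = inj₁ (q-prime , q∣e)
    ... | inj₁ q∣p with prime⇒irreducible p-prime q∣p
    ...   | inj₁ refl = contradiction (prime⇒nonTrivial q-prime) λ ()
    ...   | inj₂ q≡p  = inj₂ q≡p

  μ-∤ : ¬ p ∣ e → μ (p * e) ≡ - μ e
  μ-∤ p∤e rewrite hasSquareFactor-∤ p∤e | ω-∤ p∤e with hasSquareFactor e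
  ... | true  = refl
  ... | false = ℤP.-1*i≡-i ((- + 1) ℤ.^ ω e)

prime-divisor : ∀ m → 2 ≤ m → ∃ λ p → Prime p × p ∣ m
prime-divisor m 2≤m = go (factorise m {{ℕ.>-nonZero (ℕP.≤-trans (s≤s z≤n) 2≤m)}})
  where
  go : PrimeFactorisation m → ∃ λ p → Prime p × p ∣ m
  go record { factors = []     ; isFactorisation = m≡1 }    = contradiction m≡1 (λ { refl → ℕP.<-irrefl refl 2≤m })
  go record { factors = p ∷ ps ; isFactorisation = eq ; factorsPrime = p-prime ∷ _ } =
    p , p-prime , subst (p ∣_) (sym eq) (m∣m*n _)

μ-if-∣ : ℕ → ℕ → ℤ
μ-if-∣ m d = if does (d ∣? m) then μ d else + 0

-- Each squarefree divisor d prime to p cancels against p * d.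
module _ {m p : ℕ} (0<m : 0 < m) (p-prime : Prime p) (p∣m : p ∣ m) where

  private
    instance
      p≢0 : NonZero p
      p≢0 = prime⇒nonZero p-prime
      m≢0 : NonZero m
      m≢0 = ℕ.>-nonZero 0<m
    F = μ-if-∣ m
    -- Re-indexes the multiples of `p`: summed over `e` it selects the multiples `d` of `p`, summed
    -- over `d` it evaluates `F` at `p * e`.
    hit : ℕ → ℕ → ℤ
    hit d e = if does (p * e ℕP.≟ d) then F d else + 0
    coprime-part multiple-part : ℕ → ℤ
    coprime-part d = if does (p ∣? d) then + 0 else F d
    multiple-part d = if does (p ∣? d) then F d else + 0

  -- If p divides e, then p·e has a square factor and both sides vanish. Otherwise p·e divides m
  -- exactly when e does, and the extra prime changes the sign of μ.
  F-multiple : ∀ e → 0 < e → F (p * e) ≡ - coprime-part e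
  F-multiple e 0<e with p ∣? e
  ... | yes p∣e = zero-or-zero
    where
    zero-or-zero : F (p * e) ≡ + 0
    zero-or-zero with p * e ∣? m
    ... | yes _ = μ-∣ p-prime 0<e p∣e
    ... | no  _ = refl
  ... | no p∤e with e ∣? m
  ...   | yes e∣m = trans (if-yes (p * e ∣? m) pe∣m) (μ-∤ p-prime 0<e p∤e)
    where
    pe∣m : p * e ∣ m
    pe∣m = subst (p * e ∣_) (sym (m∣n⇒n≡quotient*m e∣m)) (*-monoˡ-∣ e
      (Sum.[ id , (λ p∣e → contradiction p∣e p∤e) ]′ (euclidsLemma (quotient e∣m) e p-prime
        (subst (p ∣_) (m∣n⇒n≡quotient*m e∣m) p∣m))))
  ...   | no e∤m = if-no (p * e ∣? m) (e∤m ∘ m*n∣⇒n∣ p e)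

  hits-of-divisor : ∀ N d → 0 < d → d ≤ N → Σ₁ N (hit d) ≡ multiple-part d
  hits-of-divisor N d 0<d d≤N with p ∣? d
  ... | no p∤d = Σ₁-zero {hit d} N (λ e _ _ → if-no (p * e ℕP.≟ d) (λ { refl → p∤d (m∣m*n e) }))
  ... | yes (divides zero refl) = contradiction 0<d (ℕP.<-irrefl refl)
  ... | yes (divides q@(suc _) refl) = trans
    (Σ₁-single {hit (q * p)} N q (s≤s z≤n) (ℕP.≤-trans (ℕP.m≤m*n q p) d≤N)
      (λ e e≢q → if-no (p * e ℕP.≟ q * p) (λ eq → e≢q (ℕP.*-cancelˡ-≡ e q p (trans eq (ℕP.*-comm q p))))))
    (if-yes (p * q ℕP.≟ q * p) (ℕP.*-comm p q))

  hits-of-multiple : ∀ N → m ≤ N → ∀ e → 0 < e → Σ₁ N (λ d → hit d e) ≡ F (p * e)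
  hits-of-multiple N m≤N e 0<e with p * e ℕP.≤? N
  ... | yes pe≤N = trans
    (Σ₁-single {λ d → hit d e} N (p * e) (ℕP.*-mono-≤ (ℕ.>-nonZero⁻¹ p) 0<e) pe≤N (λ d d≢ → if-no (p * e ℕP.≟ d) (d≢ ∘ sym)))
    (if-yes (p * e ℕP.≟ p * e) refl)
  -- A product beyond `N` exceeds `m` and cannot divide it, so both sides vanish.
  ... | no pe≰N = trans
    (Σ₁-zero {λ d → hit d e} N (λ d _ d≤N → if-no (p * e ℕP.≟ d) (λ { refl → pe≰N d≤N })))
    (sym (if-no (p * e ∣? m) (λ pe∣m → pe≰N (ℕP.≤-trans (∣⇒≤ pe∣m) m≤N))))

  Σμ-cancels : ∀ N → m ≤ N → Σ₁ N F ≡ + 0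
  Σμ-cancels N m≤N = begin
    Σ₁ N F                                                            ≡⟨ Σ₁-cong N (λ d _ _ → split d) ⟩
    Σ₁ N (λ d → coprime-part d ℤ.+ multiple-part d)                   ≡⟨ sumℤ-+ _ _ (upTo N) ⟩
    Σ₁ N coprime-part ℤ.+ Σ₁ N multiple-part
      ≡⟨ cong (ℤ._+_ (Σ₁ N coprime-part)) (Σ₁-cong N (hits-of-divisor N)) ⟨
    Σ₁ N coprime-part ℤ.+ Σ₁ N (λ d → Σ₁ N (hit d))
      ≡⟨ cong (ℤ._+_ (Σ₁ N coprime-part)) (sumℤ-swap (λ d e → hit (suc d) (suc e)) (upTo N) (upTo N)) ⟩
    Σ₁ N coprime-part ℤ.+ Σ₁ N (λ e → Σ₁ N (λ d → hit d e))
      ≡⟨ cong (ℤ._+_ (Σ₁ N coprime-part)) (Σ₁-cong N (λ e 0<e _ → trans (hits-of-multiple N m≤N e 0<e) (F-multiple e 0<e))) ⟩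
    Σ₁ N coprime-part ℤ.+ Σ₁ N (λ e → - coprime-part e)               ≡⟨ sumℤ-+ (coprime-part ∘ suc) _ (upTo N) ⟨
    Σ₁ N (λ e → coprime-part e ℤ.+ - coprime-part e)
      ≡⟨ Σ₁-zero N (λ e _ _ → ℤP.+-inverseʳ (coprime-part e)) ⟩
    + 0                                                               ∎
    where
    split : ∀ d → F d ≡ coprime-part d ℤ.+ multiple-part d
    split d with does (p ∣? d)
    ... | true  = sym (ℤP.+-identityˡ (F d))
    ... | false = sym (ℤP.+-identityʳ (F d))

-- The bound `N` is separate from `m` because the sum over divisors of `n` is later restricted to
-- those of a quotient of `n`.
Σμ : ∀ N m → 0 < m → m ≤ N → Σ₁ N (μ-if-∣ m) ≡ (if does (m ℕP.≟ 1) then + 1 else + 0)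
Σμ N m 0<m m≤N with m ℕP.≟ 1
... | yes refl = Σ₁-single {μ-if-∣ 1} N 1 (s≤s z≤n) m≤N (λ d d≢1 → if-no (d ∣? 1) (d≢1 ∘ ∣1⇒≡1))
... | no m≢1 = let p , p-prime , p∣m = prime-divisor m (ℕP.≤∧≢⇒< 0<m (m≢1 ∘ sym)) in
  trans (Σμ-cancels 0<m p-prime p∣m N m≤N) (sym (if-no (m ℕP.≟ 1) m≢1))

-- Counting primitive words

word : .{{_ : NonZero n}} → Vec (Fin k) n → Word k
word {n} v m = lookup v (m mod n)

word-period : .{{_ : NonZero n}} (v : Vec (Fin k) n) → Period n (word v)
word-period {n} v m = cong (lookup v) (mod-cong n (trans (cong (_% n) (ℕP.+-comm n m)) ([m+n]%n≡m%n m n)))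

word-block : ∀ n .{{_ : NonZero n}} (s : Word k) → Period n s → ∀ m → word (block n s) m ≡ s m
word-block n s per m = trans (VecP.lookup∘tabulate _ (m mod n)) (trans (cong s (toℕ-mod m n)) (sym (period-% n per m)))

block-word : .{{_ : NonZero n}} (v : Vec (Fin k) n) → block n (word v) ≡ v
block-word v = lookup-ext λ i → trans (VecP.lookup∘tabulate _ i) (cong (lookup v) (toℕ-mod-inverse i))

period-cong : {s t : ℕ → A} → ∀ e → (∀ m → s m ≡ t m) → Period e s → Period e t
period-cong e eq per m = trans (sym (eq (e + m))) (trans (per m) (eq m))

period-∣ : {s : ℕ → A} → ∀ {e n} → e ∣ n → Period e s → Period n s
period-∣ {e = e} (divides q refl) per = period-* e per q

-- A word of period `e` is determined by its first `e` letters, and any choice of them repeats to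
-- period `n` as `e` divides `n`.
period-card : ∀ e n .{{_ : NonZero e}} .{{_ : NonZero n}} → e ∣ n →
  HasCard {A = Vec (Fin k) n} (λ v → Period e (word v)) (k ℕ.^ e)
period-card {k = k} e n e∣n = hasCard-image (λ u → block n (word u))
  (λ u _ → period-cong e (λ m → sym (extend u m)) (word-period u))
  (λ u u′ _ _ eq → trans (sym (block-word u)) (trans
    (block-cong e (λ m → trans (sym (extend u m)) (trans (cong (λ v → word v m) eq) (extend u′ m))))
    (block-word u′)))
  (λ v per → block e (word v) , tt , trans (block-cong n (word-block e (word v) per)) (block-word v))
  (hasCard-Vec k e)
  where
  extend : ∀ (u : Vec (Fin k) e) m → word (block n (word u)) m ≡ word u m
  extend u = word-block n (word u) (period-∣ e∣n (word-period u))

module _ {s : ℕ → A} {p n : ℕ} .{{_ : NonZero n}} (lp : LeastPeriod p s) (p∣n : p ∣ n) where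

  exponent-1⇒aperiodic : quotient p∣n ≡ 1 → Aperiodic n s
  exponent-1⇒aperiodic q≡1 e 0<e e<n perE = ℕP.<⇒≱ e<n (ℕP.≤-trans
    (ℕP.≤-reflexive (trans (m∣n⇒n≡quotient*m p∣n) (trans (cong (_* p) q≡1) (ℕP.+-identityʳ p))))
    (∣⇒≤ {{ℕ.>-nonZero 0<e}} (proj₂ (proj₂ lp) e perE)))

  aperiodic⇒exponent-1 : Aperiodic n s → quotient p∣n ≡ 1
  aperiodic⇒exponent-1 aper with ℕP.m≤n⇒m<n∨m≡n (∣⇒≤ p∣n)
  ... | inj₁ p<n = contradiction (proj₁ (proj₂ lp)) (aper p (proj₁ lp) p<n)
  ... | inj₂ p≡n = ℕP.*-cancelʳ-≡ (quotient p∣n) 1 p {{ℕ.>-nonZero (proj₁ lp)}}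
    (trans (sym (m∣n⇒n≡quotient*m p∣n)) (trans (sym p≡n) (sym (ℕP.*-identityˡ p))))

module _ (k n : ℕ) .{{_ : NonZero n}} where

  private
    0<n : 0 < n
    0<n = ℕ.>-nonZero⁻¹ n

    wordPeriod? : ∀ e (v : Vec (Fin k) n) → Dec (Period e (word v))
    wordPeriod? e v = period? (word v) n (word-period v) e

    exponent : (v : Vec (Fin k) n) → ∃ λ p → LeastPeriod p (word v) × p ∣ n
    exponent v = let p , 0<p , per , least = leastPeriod (word v) n 0<n (word-period v)
                 in p , (0<p , per , least) , least n (word-period v)

  aperiodic? : ∀ (v : Vec (Fin k) n) → Dec (Aperiodic n (word v))
  aperiodic? v = let p , lp , p∣n = exponent v in
    map′ (exponent-1⇒aperiodic lp p∣n) (aperiodic⇒exponent-1 lp p∣n) (quotient p∣n ℕP.≟ 1)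

  private
    -- The share of the single word `v` in the d-th Möbius term, whose power of `k` counts the words
    -- of period `n / d`. The division requires a separate clause for 0.
    term : ℕ → Vec (Fin k) n → ℤ
    term zero      v = + 0
    term d@(suc _) v = if does (d ∣? n) then μ d ℤ.* (if does (wordPeriod? (n / d) v) then + 1 else + 0) else + 0

  divisor-term : ∀ d → (if does (suc d ∣? n) then μ (suc d) ℤ.* (+ (k ℕ.^ (n / suc d))) else + 0)
    ≡ sumℤ (term (suc d)) (allVecs k n)
  divisor-term d with suc d ∣? n
  ... | no d∤n = trans (if-no (suc d ∣? n) d∤n)
    (sym (trans (sumℤ-cong (λ v → if-no (suc d ∣? n) d∤n) (allVecs k n)) (sumℤ-zero (allVecs k n))))
  ... | yes d∣n = trans (if-yes (suc d ∣? n) d∣n) (trans (cong (μ (suc d) ℤ.*_) count)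
      (trans (sumℤ-*ˡ (μ (suc d)) _ (allVecs k n)) (sumℤ-cong (λ v → sym (if-yes (suc d ∣? n) d∣n)) (allVecs k n))))
    where
    e = n / suc d
    e∣n : e ∣ n
    e∣n = m/n∣m d∣n
    instance
      e≢0 : NonZero e
      e≢0 = ℕ.>-nonZero (m≥n⇒m/n>0 (∣⇒≤ d∣n))
    count : + (k ℕ.^ e) ≡ sumℤ (λ v → if does (wordPeriod? e v) then + 1 else + 0) (allVecs k n)
    count = trans (cong +_ (hasCard-unique (period-card e n e∣n)
        (hasCard-filter (wordPeriod? e) (allVecs-unique k n) (λ _ → ∈-allVecs _))))
      (sym (sumℤ-indicator (wordPeriod? e) (allVecs k n)))

  -- With p the least period and q = n/p, a divisor d of n makes n/d a period exactly when p divides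
  -- n/d, that is, when d divides q. The sum of μ over the divisors of q is 1 for q = 1 and 0
  -- otherwise.
  word-terms : ∀ v → Σ₁ n (λ d → term d v) ≡ (if does (aperiodic? v) then + 1 else + 0)
  word-terms v = trans (Σ₁-cong n terms) (Σμ n q 0<q (∣⇒≤ (quotient-∣ p∣n)))
    where
    p = proj₁ (exponent v)
    least = proj₂ (proj₂ (proj₁ (proj₂ (exponent v))))
    per = proj₁ (proj₂ (proj₁ (proj₂ (exponent v))))
    p∣n = proj₂ (proj₂ (exponent v))
    q = quotient p∣n
    instance
      p≢0 : NonZero p
      p≢0 = ℕ.>-nonZero (proj₁ (proj₁ (proj₂ (exponent v))))
    0<q : 0 < q
    0<q = ℕ.>-nonZero⁻¹ q {{quotient≢0 p∣n}}
    n≡qp = m∣n⇒n≡quotient*m p∣n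
    terms : ∀ d → 0 < d → d ≤ n → term d v ≡ μ-if-∣ q d
    terms d@(suc d′) _ _ with d ∣? q
    ... | yes d∣q = trans (if-yes (d ∣? n) d∣n) (trans
            (cong (μ d ℤ.*_) (if-yes (wordPeriod? (n / d) v) (period-∣ p∣n/d per)))
            (trans (ℤP.*-identityʳ (μ d)) (sym (if-yes (d ∣? q) d∣q))))
      where
      dp∣n : d * p ∣ n
      dp∣n = subst (d * p ∣_) (sym n≡qp) (*-monoˡ-∣ p d∣q)
      d∣n : d ∣ n
      d∣n = m*n∣⇒m∣ d p dp∣n
      p∣n/d : p ∣ n / d
      p∣n/d = m*n∣o⇒n∣o/m d p dp∣n
    ... | no d∤q = trans vanish (sym (if-no (d ∣? q) d∤q))
      where
      vanish : term d v ≡ + 0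
      vanish with d ∣? n
      ... | no d∤n = if-no (d ∣? n) d∤n
      ... | yes d∣n = trans (if-yes (d ∣? n) d∣n) (trans (cong (μ d ℤ.*_) (if-no (wordPeriod? (n / d) v)
            (λ perD → d∤q (*-cancelʳ-∣ p (subst (d * p ∣_) n≡qp (m∣n/o⇒o*m∣n d∣n (least (n / d) perD)))))))
            (ℤP.*-zeroʳ (μ d)))

  mobiusSum-card : mobiusSum k n ≡ + length (filter aperiodic? (allVecs k n))
  mobiusSum-card = begin
    mobiusSum k n                                                            ≡⟨ sumℤ-cong divisor-term (upTo n) ⟩
    Σ₁ n (λ d → sumℤ (term d) (allVecs k n))
      ≡⟨ sumℤ-swap (λ d → term (suc d)) (upTo n) (allVecs k n) ⟩
    sumℤ (λ v → Σ₁ n (λ d → term d v)) (allVecs k n)                         ≡⟨ sumℤ-cong word-terms (allVecs k n) ⟩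
    sumℤ (λ v → if does (aperiodic? v) then + 1 else + 0) (allVecs k n)
      ≡⟨ sumℤ-indicator aperiodic? (allVecs k n) ⟩
    + length (filter aperiodic? (allVecs k n))                               ∎

-- Cycles, patterns and primitive words

CycleWithAscents : ℕ → Perm n → Set
CycleWithAscents r τ = IsPerm τ × IsCycle τ × ascents (toList τ) ≡ r

C′-card : ∀ n i → HasCard {A = Perm n} (CycleWithAscents (i ∸ 1)) (C′ n i)
C′-card n i = hasCard-filter
  (λ π → unique? FinP._≟_ (toList π) ×-dec isCycle? π ×-dec (ascents (toList π) ℕ.≟ (i ∸ 1)))
  (allVecs-unique n n) (λ _ → ∈-allVecs _)

aperiodic-cong : {s t : ℕ → A} → (∀ m → s m ≡ t m) → Aperiodic n s → Aperiodic n t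
aperiodic-cong eq aper e 0<e e<n per = aper e 0<e e<n (period-cong e (λ m → sym (eq m)) per)

pattern-cong : {s t : Word k} {π : Perm n} → (∀ m → s m ≡ t m) →
  IsPattern (reverseSigns k) s π → IsPattern (reverseSigns k) t π
pattern-cong {k} {n} {s} {t} eq (perm , pat) = perm , λ i j →
  (λ lt → ⊏⇒≺ (⊏-resp (shift i) (shift j) (≺⇒⊏ (proj₁ (pat i j) lt)))) ,
  (λ lt → proj₂ (pat i j) (⊏⇒≺ (⊏-resp (λ m → sym (shift i m)) (λ m → sym (shift j m)) (≺⇒⊏ lt))))
  where
  shift : ∀ (i : Fin n) m → shiftBy (toℕ i) s m ≡ shiftBy (toℕ i) t m
  shift i m = eq (toℕ i + m)

compatible⇒ascents<k : ∀ {m} (xs : Vec (Fin n) (suc m)) (cs : Vec (Fin k) (suc m)) →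
  Compatible xs cs → ascents (toList xs) < k
compatible⇒ascents<k (x ∷ xs) (c ∷ cs) com = ℕP.m+n≤o⇒m≤o (suc (ascents (x ∷ toList xs))) (compatible⇒ascents x xs c cs com)

ascents<k⇒compatible : ∀ {m} (xs : Vec (Fin n) (suc m)) → Unique (toList xs) → ascents (toList xs) < k →
  ∃ λ (cs : Vec (Fin k) (suc m)) → Compatible xs cs
ascents<k⇒compatible {k = k} (x ∷ xs) unique asc<k =
  let c , cs , _ , com = ascents⇒compatible x xs unique 0 (subst (_< k) (sym (ℕP.+-identityʳ _)) asc<k) in c ∷ cs , com

sum-map-*ʳ : ∀ (f : A → ℕ) c xs → sum (map (λ x → f x * c) xs) ≡ sum (map f xs) * c
sum-map-*ʳ f c []       = refl
sum-map-*ʳ f c (x ∷ xs) = trans (cong (_+_ (f x * c)) (sum-map-*ʳ f c xs)) (sym (ℕP.*-distribʳ-+ c (f x) _))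

sum-upTo-head : ∀ (f : ℕ → ℕ) K → sum (map f (upTo (suc K))) ≡ f 0 + sum (map (f ∘ suc) (upTo K))
sum-upTo-head f K = cong (λ xs → f 0 + sum xs) (trans (map-applyUpTo suc f K) (sym (map-applyUpTo id (f ∘ suc) K)))

[m+n]-m : ∀ m n → + (m + n) - + m ≡ + n
[m+n]-m m n = begin
  + (m + n) - + m          ≡⟨ cong (λ z → + z - + m) (ℕP.+-comm m n) ⟩
  + (n + m) - + m          ≡⟨ ℤP.+-assoc (+ n) (+ m) (- + m) ⟩
  + n ℤ.+ (+ m - + m)      ≡⟨ cong (ℤ._+_ (+ n)) (ℤP.+-inverseʳ (+ m)) ⟩
  + n ℤ.+ + 0              ≡⟨ ℤP.+-identityʳ (+ n) ⟩
  + n                      ∎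

module _ (m : ℕ) (n%4≢2 : suc m % 4 ≢ 2) where

  private
    N = suc m

  patterns-card : ∀ k → HasCard (InPatterns (reverseSigns k) N) (sum (map (λ i → C′ N (suc i) * N) (upTo k)))
  patterns-card k = hasCard-image (λ (τ , x) → orbit τ x) realise injective onto
    (hasCard-⋃ {R = λ i (τ , x) → CycleWithAscents i τ × ⊤}
      (λ ((_ , _ , eq) , _) ((_ , _ , eq′) , _) → trans (sym eq) eq′)
      -- Here `i` is the number of ascents, while `C′` is indexed by one more.
      (λ i → hasCard-Σ (C′-card N (suc i)) (λ _ _ → hasCard-Fin N)) k)
    where
    Realisable : Perm N × Fin N → Set
    Realisable (τ , x) = ∃ λ i → i < k × CycleWithAscents i τ × ⊤
    realise : ∀ t → Realisable t → InPatterns (reverseSigns k) N (orbit (proj₁ t) (proj₂ t))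
    realise (τ , x) (i , i<k , (perm , cyc , refl) , _) =
      let f , com = ascents<k⇒compatible τ perm i<k
          open Coding n%4≢2 τ cyc f com
      in letters x , letters-InW x , letters-pattern x
    injective : ∀ t t′ → Realisable t → Realisable t′ → orbit (proj₁ t) (proj₂ t) ≡ orbit (proj₁ t′) (proj₂ t′) → t ≡ t′
    injective (τ , x) (τ′ , x′) (_ , _ , (_ , cyc , _) , _) (_ , _ , (_ , cyc′ , _) , _) eq =
      let τ≡ , x≡ = orbit-injective τ τ′ cyc cyc′ x x′ eq in cong₂ _,_ τ≡ x≡
    onto : ∀ π → InPatterns (reverseSigns k) N π → ∃ λ t → Realisable t × orbit (proj₁ t) (proj₂ t) ≡ π
    onto π (s , (per , _) , pat) =
      let open Decoding s per π pat in
      (successor , at 0) ,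
      (ascents (toList successor) , compatible⇒ascents<k successor labels successor-compatible ,
        (Cyclic.cycle⇒perm successor successor-cycle , successor-cycle , refl) , tt) ,
      orbit-successor

  Coded : ∀ k → ℕ → Perm N × (Vec (Fin k) N × Fin N) → Set
  Coded k i (τ , f , x) = CycleWithAscents i τ × (Compatible τ f × ⊤)

  encode : ∀ {k} → Perm N × (Vec (Fin k) N × Fin N) → Vec (Fin k) N
  encode (τ , f , x) = block N (λ j → lookup f (iter τ j x))

  aperiodic-words-card : ∀ k → HasCard {A = Vec (Fin k) N} (λ v → Aperiodic N (word v))
    (sum (map (λ i → C′ N (suc i) * (((N + k ∸ suc i) C N) * N)) (upTo k)))
  aperiodic-words-card k = hasCard-image encode aperiodic injective onto
    (hasCard-⋃ {R = Coded k} (λ ((_ , _ , eq) , _) ((_ , _ , eq′) , _) → trans (sym eq) eq′)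
      (λ i → hasCard-Σ (C′-card N (suc i)) λ τ (perm , _ , asc≡i) →
        hasCard-Σ (subst (λ r → HasCard (Compatible τ) ((N + k ∸ suc r) C N)) asc≡i (compatible-card τ perm))
          (λ _ _ → hasCard-Fin N)) k)
    where
    Triple = Perm N × (Vec (Fin k) N × Fin N)
    Valid : Triple → Set
    Valid t = ∃ λ i → i < k × Coded k i t
    letter : Triple → Word k
    letter (τ , f , x) j = lookup f (iter τ j x)
    word-encode : ∀ t → Valid t → ∀ j → word (encode t) j ≡ letter t j
    word-encode t@(τ , f , x) (_ , _ , (_ , cyc , _) , com , _) =
      word-block N (letter t) (Coding.letters-period n%4≢2 τ cyc f com x)
    aperiodic : ∀ t → Valid t → Aperiodic N (word (encode t))
    aperiodic t@(τ , f , x) valid@(_ , _ , (_ , cyc , _) , com , _) =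
      aperiodic-cong (λ j → sym (word-encode t valid j)) (Coding.letters-aperiodic n%4≢2 τ cyc f com x)
    encode-letter : ∀ t t′ → Valid t → Valid t′ → encode t ≡ encode t′ → ∀ j → letter t j ≡ letter t′ j
    encode-letter t t′ valid valid′ eq j =
      trans (sym (word-encode t valid j)) (trans (cong (λ v → word v j) eq) (word-encode t′ valid′ j))
    injective : ∀ t t′ → Valid t → Valid t′ → encode t ≡ encode t′ → t ≡ t′
    injective t@(τ , f , x) t′@(τ′ , f′ , x′)
      valid@(_ , _ , (_ , cyc , _) , com , _) valid′@(_ , _ , (_ , cyc′ , _) , com′ , _) eq
      with encode-letter t t′ valid valid′ eq
    ... | same
      -- Equal words have equal patterns, and the pattern determines `τ` and `x`; the labels are
      -- then read off the word along the orbit.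
      with orbit-injective τ τ′ cyc cyc′ x x′ (pattern-unique (reverseSigns k) (letter t) _ _
             (Coding.letters-pattern n%4≢2 τ cyc f com x)
             (pattern-cong (λ j → sym (same j)) (Coding.letters-pattern n%4≢2 τ′ cyc′ f′ com′ x′)))
    ... | refl , refl = cong (λ f → τ , f , x) (lookup-ext λ a → at-orbit a (cyc x a))
      where
      at-orbit : ∀ a → (∃ λ (j : Fin N) → iter τ (toℕ j) x ≡ a) → lookup f a ≡ lookup f′ a
      at-orbit a (j , refl) = same (toℕ j)
    onto : ∀ v → Aperiodic N (word v) → ∃ λ t → Valid t × encode t ≡ v
    onto v aper =
      -- Aperiodicity makes the shifts distinct, so they can be ranked; decoding the resulting
      -- pattern gives the triple.
      let open Ranking (word v) (word-period v) aper
          open Decoding (word v) (word-period v) ranking ranking-pattern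
      in (successor , labels , at 0) ,
         (ascents (toList successor) , compatible⇒ascents<k successor labels successor-compatible ,
           (Cyclic.cycle⇒perm successor successor-cycle , successor-cycle , refl) , successor-compatible , tt) ,
         trans (block-cong N labels-orbit) (block-word v)

  -- The choice of `x` contributes the common factor `N`, which makes the division in `L` exact.
  L-expansion : ∀ k → L k N ≡ + sum (map (λ i → ((N + k ∸ suc i) C N) * C′ N (suc i)) (upTo k))
  L-expansion k = trans (cong (ℤ._/ℕ N) total) (cong +_ (m*n/n≡m _ N))
    where
    total : mobiusSum k N ≡ + (sum (map (λ i → ((N + k ∸ suc i) C N) * C′ N (suc i)) (upTo k)) * N)
    total = trans (mobiusSum-card k N) (cong +_ (begin
      length (filter (aperiodic? k N) (allVecs k N))
        ≡⟨ hasCard-unique (hasCard-filter (aperiodic? k N) (allVecs-unique k N) (λ _ → ∈-allVecs _))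
             (aperiodic-words-card k) ⟩
      sum (map (λ i → C′ N (suc i) * (((N + k ∸ suc i) C N) * N)) (upTo k))
        ≡⟨ cong sum (map-cong (λ i → rearrange (C′ N (suc i)) ((N + k ∸ suc i) C N)) (upTo k)) ⟩
      sum (map (λ i → ((N + k ∸ suc i) C N) * C′ N (suc i) * N) (upTo k))
        ≡⟨ sum-map-*ʳ (λ i → ((N + k ∸ suc i) C N) * C′ N (suc i)) N (upTo k) ⟩
      sum (map (λ i → ((N + k ∸ suc i) C N) * C′ N (suc i)) (upTo k)) * N ∎))
      where
      rearrange : ∀ a b → a * (b * N) ≡ b * a * N
      rearrange a b = trans (sym (ℕP.*-assoc a b N)) (cong (_* N) (ℕP.*-comm a b))

  -- A cycle without ascents would be compatible with a constant, hence periodic, word.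
  C′-one : 3 ≤ N → C′ N 1 ≡ 0
  C′-one 3≤n = hasCard-unique (C′-card N 1) (hasCard-∅ impossible)
    where
    impossible : ∀ τ → ¬ CycleWithAscents 0 τ
    impossible τ (perm , cyc , asc≡0) =
      let f , com = ascents<k⇒compatible {k = 1} τ perm (s≤s (ℕP.≤-reflexive asc≡0))
      in Coding.letters-aperiodic n%4≢2 τ cyc f com zero 1 (s≤s z≤n) (ℕP.<-trans (s≤s (s≤s z≤n)) 3≤n)
           (λ _ → constant _ _)
      where
      constant : ∀ (a b : Fin 1) → a ≡ b
      constant zero zero = refl

  -- Symmetry of the binomial exchanges the lower index K - i for N; the range of `j` ensures that i
  -- ≤ K, so nothing is truncated.
  correctionSum-expansion : ∀ J → correctionSum N (suc (suc J))
    ≡ + sum (map (λ i → ((N + suc (suc J) ∸ suc (suc i)) C N) * C′ N (suc (suc i))) (upTo J))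
  correctionSum-expansion J = cong +_ (go (upTo J) (λ j∈ → ∈-upTo⁻ j∈))
    where
    K = suc (suc J)
    binomial : ∀ j → j < J → (N + K ∸ (j + 2)) C (K ∸ (j + 2)) ≡ (N + K ∸ suc (suc j)) C N
    binomial j j<J rewrite ℕP.+-comm j 2 | ℕP.+-∸-assoc N {K} {suc (suc j)} (s≤s (s≤s (ℕP.<⇒≤ j<J))) =
      sym (trans (nCk≡nC[n∸k] (ℕP.m≤m+n N _)) (cong ((N + (J ∸ j)) C_) (ℕP.m+n∸m≡n N (J ∸ j))))
    go : ∀ js → (∀ {j} → j ∈ js → j < J) →
      sum (map (λ j → let i = j + 2 in ((N + K ∸ i) C (K ∸ i)) * C′ N i) js)
        ≡ sum (map (λ i → ((N + K ∸ suc (suc i)) C N) * C′ N (suc (suc i))) js)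
    go []       bound = refl
    go (j ∷ js) bound = cong₂ _+_
      (cong₂ _*_ (binomial j (bound (here refl))) (cong (C′ N) (ℕP.+-comm j 2)))
      (go js (bound ∘ there))

theorem3p11 : ∀ (n k : ℕ) → 3 ≤ n → n % 4 ≢ 2 → 3 ≤ k →
    ∃ λ (a : ℕ) → ∃ λ (b : ℕ) →
    HasCard (InPatterns (reverseSigns k) n) a
    × HasCard (InPatterns (reverseSigns (k ∸ 1)) n) b
    × (+ quot a n - + quot b n ≡ + C′ n k)
    × (+ C′ n k ≡ L k n - correctionSum n k)
theorem3p11 n@(suc m) k@(suc K@(suc J)) 3≤n@(s≤s _) n%4≢2 (s≤s (s≤s _)) =
  _ , _ , patterns-card m n%4≢2 k , patterns-card m n%4≢2 K , difference , recurrence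
  where
  cycles : ℕ → ℕ
  cycles K = sum (map (λ i → C′ n (suc i)) (upTo K))
  classes : ∀ K → quot (sum (map (λ i → C′ n (suc i) * n) (upTo K))) n ≡ cycles K
  classes K = trans (cong (_/ n) (sum-map-*ʳ (λ i → C′ n (suc i)) n (upTo K))) (m*n/n≡m (cycles K) n)
  difference : + quot (sum (map (λ i → C′ n (suc i) * n) (upTo k))) n
             - + quot (sum (map (λ i → C′ n (suc i) * n) (upTo K))) n ≡ + C′ n k
  difference = begin
    _                                   ≡⟨ cong₂ (λ a b → + a - + b) (classes k) (classes K) ⟩
    + cycles k - + cycles K             ≡⟨ cong (λ a → + a - + cycles K) (sum-upTo-suc (λ i → C′ n (suc i)) K) ⟩
    + (cycles K + C′ n k) - + cycles K  ≡⟨ [m+n]-m (cycles K) (C′ n k) ⟩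
    + C′ n k                            ∎
  summand : ℕ → ℕ
  summand i = ((n + k ∸ suc i) C n) * C′ n (suc i)
  middle = sum (map (summand ∘ suc) (upTo J))
  -- Index 0 stands for cycles without ascents and disappears by `C′-one`; the last index `K` has
  -- coefficient `n C n`, which is 1.
  expansion : sum (map summand (upTo k)) ≡ middle + C′ n k
  expansion = begin
    sum (map summand (upTo k))                            ≡⟨ sum-upTo-head summand K ⟩
    summand 0 + sum (map (summand ∘ suc) (upTo K))
      ≡⟨ cong (λ a → ((n + k ∸ 1) C n) * a + sum (map (summand ∘ suc) (upTo K))) (C′-one m n%4≢2 3≤n) ⟩
    ((n + k ∸ 1) C n) * 0 + sum (map (summand ∘ suc) (upTo K))
      ≡⟨ cong (_+ sum (map (summand ∘ suc) (upTo K))) (ℕP.*-zeroʳ ((n + k ∸ 1) C n)) ⟩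
    sum (map (summand ∘ suc) (upTo K))                    ≡⟨ sum-upTo-suc (summand ∘ suc) J ⟩
    middle + ((n + k ∸ k) C n) * C′ n k                   ≡⟨ cong (λ a → middle + (a C n) * C′ n k) (ℕP.m+n∸n≡m n k) ⟩
    middle + (n C n) * C′ n k                             ≡⟨ cong (λ a → middle + a * C′ n k) (nCn≡1 n) ⟩
    middle + 1 * C′ n k                                   ≡⟨ cong (_+_ middle) (ℕP.*-identityˡ (C′ n k)) ⟩
    middle + C′ n k                                       ∎
  recurrence : + C′ n k ≡ L k n - correctionSum n k
  recurrence = sym (begin
    L k n - correctionSum n k           ≡⟨ cong₂ _-_ (L-expansion m n%4≢2 k) (correctionSum-expansion m n%4≢2 J) ⟩
    + sum (map summand (upTo k)) - + middle ≡⟨ cong (λ a → + a - + middle) expansion ⟩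
    + (middle + C′ n k) - + middle      ≡⟨ [m+n]-m middle (C′ n k) ⟩
    + C′ n k                            ∎)
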